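{- Let $\kappa$ be a regular uncountable cardinal and let $\Gamma$ be a class which projects downward and such that $M\cap\kappa\in\kappa$ for every $M\in\Gamma$. Then $\Diamond^-_{\mathrm{Lav}}(\Gamma)$ holds if and only if $\Diamond_{\mathrm{Lav}}(\Gamma)$ holds.
   Context: For a set $A$, a set $S\subseteq\wp(A)$ is stationary iff for every first-order structure $\mathfrak A$ with universe $A$ in a countable language there is $M\in S$ with $M\prec\mathfrak A$. For a set $X$ such that $(X,\in)$ is extensional, $H_X$ denotes the transitive collapse of $X$ and $\sigma_X:H_X\to X$ denotes the inverse of the Mostowski collapsing isomorphism. Let $\kappa$ be regular uncountable and $F:\kappa\to V$. For a set $b$ and regular uncountable $\theta$: $G^{b,\theta}_{=F}$ is the set of $M$ with (a) $b\in M\prec(H_\theta,\in)$, (b) $M\cap\kappa\in\kappa$, (c) $\sigma_M^{ -1}(b)=F(M\cap\kappa)$; and $G^{b,\theta}_{\in F}$ is defined identically except (c) is replaced by $\sigma_M^{ -1}(b)\in F(M\cap\kappa)$. For a class $\Gamma$: $F$ is a $\Diamond_{\mathrm{Lav}}(\Gamma)$ function iff for every set $b$ and every sufficiently large regular $\theta$, $\Gamma\cap G^{b,\theta}_{=F}$ is stationary. $F$ is a $\Diamond^-_{\mathrm{Lav}}(\Gamma)$ function iff (A) for every set $b$ and every sufficiently large regular $\theta$, $\Gamma\cap G^{b,\theta}_{\in F}$ is stationary, and (B) $|F(\alpha)|\le|\alpha|$ for every $\alpha<\kappa$. $\Diamond_{\mathrm{Lav}}(\Gamma)$ (resp. $\Diamond^-_{\mathrm{Lav}}(\Gamma)$)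 holds iff there is such a function. A class $\Gamma$ projects downward iff whenever $X\in\Gamma$ and $\theta\le\sup(X\cap\mathrm{ORD})$ is a regular uncountable cardinal, then $X\cap H_\theta\in\Gamma$. -}

module Defs where

open import Level using (Level; suc)
open import Data.Empty using (⊥)
open import Data.Empty.Polymorphic using () renaming (⊥ to ⊥ₚ)
open import Data.Unit using (⊤; tt)
open import Data.Nat using (ℕ) renaming (suc to 1+)
open import Data.Fin using (Fin)
open import Data.Vec using (Vec; []; _∷_; lookup)
open import Data.Vec.Relation.Unary.All using (All)
open import Data.Product using (Σ; ∃; ∃-syntax; _×_; _,_; proj₁; proj₂)
open import Data.Sum using (_⊎_; inj₁; inj₂)
open import Function.Bundles using (_⇔_; mk⇔; _↣_; module Equivalence)
open import Induction.WellFounded using (WellFounded; Acc; acc)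
open import Relation.Nullary using (¬_)
open import Relation.Binary.PropositionalEquality
  using (_≡_; refl; sym; trans; cong; subst)

------------------------------------------------------------------------
-- The set-theoretic universe
--
-- V is an arbitrary universe of sets.  Classes are Agda predicates
-- V → Set ℓ, and the Separation and Replacement schemas range over them.
-- Foundation is stated as ∈-induction.  Classical logic is not a field;
-- it is a separate hypothesis (ExcludedMiddle) wherever it is needed.

record ZFC (ℓ : Level) : Set (suc ℓ) where
  infix 4 _∈_ _⊆_
  field
    V   : Set ℓ
    _∈_ : V → V → Set ℓ

  _⊆_ : V → V → Set ℓ
  a ⊆ b = ∀ x → x ∈ a → x ∈ b

  IsEmpty : V → Set ℓ
  IsEmpty e = ∀ x → ¬ x ∈ e

  IsSuccessor : V → V → Set ℓ
  IsSuccessor x s = ∀ y → y ∈ s ⇔ (y ∈ x ⊎ y ≡ x)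

  Inductive : V → Set ℓ
  Inductive w = (∃[ e ] IsEmpty e × e ∈ w)
              × (∀ x → x ∈ w → ∃[ s ] IsSuccessor x s × s ∈ w)

  field
    extensionality : ∀ a b → (∀ x → x ∈ a ⇔ x ∈ b) → a ≡ b
    foundation     : WellFounded _∈_
    pairing        : ∀ a b → ∃[ c ] ∀ x → x ∈ c ⇔ (x ≡ a ⊎ x ≡ b)
    union          : ∀ a → ∃[ u ] ∀ x → x ∈ u ⇔ (∃[ y ] y ∈ a × x ∈ y)
    powerset       : ∀ a → ∃[ p ] ∀ x → x ∈ p ⇔ x ⊆ a
    infinity       : ∃[ w ] Inductive w
    separation     : ∀ (P : V → Set ℓ) a → ∃[ b ] ∀ x → x ∈ b ⇔ (x ∈ a × P x)
    replacement    : ∀ (R : V → V → Set ℓ) a →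
                     (∀ x → x ∈ a → ∀ y z → R x y → R x z → y ≡ z) →
                     ∃[ b ] ∀ y → y ∈ b ⇔ (∃[ x ] x ∈ a × R x y)
    choice         : ∀ a →
                     (∀ x → x ∈ a → ∃[ y ] y ∈ x) →
                     (∀ x y z → x ∈ a → y ∈ a → z ∈ x → z ∈ y → x ≡ y) →
                     ∃[ c ] ∀ x → x ∈ a →
                       ∃[ y ] (y ∈ x × y ∈ c) × (∀ z → z ∈ x → z ∈ c → z ≡ y)

------------------------------------------------------------------------
-- First-order syntax; the variables of a Formula L n are the elements of
-- Fin n, and ∀̇ binds variable zero.  The omitted connectives are
-- classically definable.

record Language : Set₁ where
  field
    Fun Rel  : Set
    funArity : Fun → ℕ
    relArity : Rel → ℕ

open Language public

Countable : Language → Set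
Countable L = (Fun L ↣ ℕ) × (Rel L ↣ ℕ)

data Term (L : Language) (n : ℕ) : Set where
  var : Fin n → Term L n
  fun : (f : Fun L) → Vec (Term L n) (funArity L f) → Term L n

infix  6 _≐_
infixr 5 _⇒̇_

data Formula (L : Language) : ℕ → Set where
  _≐_ : ∀ {n} → Term L n → Term L n → Formula L n
  rel : ∀ {n} (r : Rel L) → Vec (Term L n) (relArity L r) → Formula L n
  ⊥̇   : ∀ {n} → Formula L n
  _⇒̇_ : ∀ {n} → Formula L n → Formula L n → Formula L n
  ∀̇   : ∀ {n} → Formula L (1+ n) → Formula L n

L∈ : Language
L∈ = record { Fun = ⊥ ; Rel = ⊤ ; funArity = λ () ; relArity = λ _ → 2 }

------------------------------------------------------------------------

module SetTheory {ℓ : Level} (𝕍 : ZFC ℓ) where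

  open ZFC 𝕍 public

  Class : Set (suc ℓ)
  Class = V → Set ℓ

  infixl 7 _∩ᶜ_ _∩_
  infix  4 _≼_ _≺_ _≤ᵒ_ _≺ᵉ_

  _∩ᶜ_ : V → Class → V
  a ∩ᶜ P = proj₁ (separation P a)

  ∈-∩ᶜ : ∀ {a} {P : Class} {x} → x ∈ (a ∩ᶜ P) ⇔ (x ∈ a × P x)
  ∈-∩ᶜ {a} {P} {x} = proj₂ (separation P a) x

  _∩_ : V → V → V
  a ∩ b = a ∩ᶜ (_∈ b)

  ⋃ : V → V
  ⋃ a = proj₁ (union a)

  ℘ : V → V
  ℘ a = proj₁ (powerset a)

  ω : V
  ω = proj₁ infinity ∩ᶜ λ n → ∀ w → Inductive w → n ∈ w

  -- Ordinals and cardinals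

  Transitive : V → Set ℓ
  Transitive a = ∀ x → x ∈ a → x ⊆ a

  -- By Foundation this is the usual notion of von Neumann ordinal.
  Ordinal : Class
  Ordinal α = Transitive α × (∀ x → x ∈ α → Transitive x)

  _≤ᵒ_ : V → V → Set ℓ
  α ≤ᵒ β = α ∈ β ⊎ α ≡ β

  -- Functions with domain a set a are given by Agda functions V → V whose
  -- values outside a are irrelevant; by Replacement their graphs on a are
  -- sets.

  Maps : (V → V) → V → V → Set ℓ
  Maps f a b = ∀ x → x ∈ a → f x ∈ b

  InjectiveOn : V → (V → V) → Set ℓ
  InjectiveOn a f = ∀ x y → x ∈ a → y ∈ a → f x ≡ f y → x ≡ y

  -- |a| ≤ |b|
  _≼_ : V → V → Set ℓ
  a ≼ b = ∃[ f ] Maps f a b × InjectiveOn a f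

  -- |a| < |b|
  _≺_ : V → V → Set ℓ
  a ≺ b = a ≼ b × ¬ b ≼ a

  Cardinal : V → Set ℓ
  Cardinal κ = Ordinal κ × (∀ α → α ∈ κ → α ≺ κ)

  -- An infinite cardinal with no cofinal map from a smaller ordinal.
  Regular : V → Set ℓ
  Regular κ = Cardinal κ
            × ω ≼ κ
            × (∀ α (f : V → V) → α ∈ κ → Maps f α κ →
               ∃[ β ] β ∈ κ × (∀ ξ → ξ ∈ α → f ξ ∈ β))

  RegularUncountable : V → Set ℓ
  RegularUncountable κ = Regular κ × ¬ κ ≼ ω

  -- The supremum of a set of ordinals is its union.
  sup : V → V
  sup = ⋃

  -- H_θ

  IsTransitiveClosure : V → V → Set ℓ
  IsTransitiveClosure x t =
    x ⊆ t × Transitive t × (∀ s → x ⊆ s → Transitive s → t ⊆ s)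

  -- |trcl(x)| < θ
  HereditarilySmaller : V → Class
  HereditarilySmaller θ x = ∃[ t ] IsTransitiveClosure x t × t ≺ θ

  -- To see that H_θ is a set, code x by a relation E on θ isomorphic to
  -- (t, ∈) for a transitive t ⊇ x, together with the subset c of θ
  -- corresponding to x.

  open Equivalence using (to; from)

  upair : V → V → V
  upair a b = proj₁ (pairing a b)

  ∈-upair : ∀ a b {x} → x ∈ upair a b ⇔ (x ≡ a ⊎ x ≡ b)
  ∈-upair a b {x} = proj₂ (pairing a b) x

  left∈ : ∀ a b → a ∈ upair a b
  left∈ a b = from (∈-upair a b) (inj₁ refl)

  right∈ : ∀ a b → b ∈ upair a b
  right∈ a b = from (∈-upair a b) (inj₂ refl)

  upair-cancel : ∀ a b c → upair a b ≡ upair a c → b ≡ c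
  upair-cancel a b c e
    with to (∈-upair a c) (subst (b ∈_) e (right∈ a b))
  ... | inj₂ b≡c = b≡c
  ... | inj₁ b≡a with to (∈-upair a b) (subst (c ∈_) (sym e) (right∈ a c))
  ...   | inj₁ c≡a = trans b≡a (sym c≡a)
  ...   | inj₂ c≡b = sym c≡b

  opair : V → V → V
  opair a b = upair (upair a a) (upair a b)

  opair-fst : ∀ {a b c d} → opair a b ≡ opair c d → a ≡ c
  opair-fst {a} {b} {c} {d} e
    with to (∈-upair (upair c c) (upair c d))
            (subst (upair a a ∈_) e (left∈ (upair a a) (upair a b)))
  ... | inj₁ p with to (∈-upair c c) (subst (a ∈_) p (left∈ a a))
  ...   | inj₁ q = q
  ...   | inj₂ q = q
  opair-fst {a} {b} {c} {d} e | inj₂ p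
    with to (∈-upair a a) (subst (c ∈_) (sym p) (left∈ c d))
  ...   | inj₁ q = sym q
  ...   | inj₂ q = sym q

  opair-injective : ∀ {a b c d} → opair a b ≡ opair c d → a ≡ c × b ≡ d
  opair-injective {a} {b} {c} {d} e with opair-fst e
  ... | refl = refl , upair-cancel a b d (upair-cancel (upair a a) _ _ e)

  Codes : V → V → V → Set ℓ
  Codes E c x =
    ∃[ t ] ∃[ j ] Transitive t × x ⊆ t × InjectiveOn t j
      × (∀ p → p ∈ E ⇔ (∃[ u ] ∃[ v ] v ∈ t × u ∈ v × p ≡ opair (j u) (j v)))
      × (∀ ξ → ξ ∈ c ⇔ (∃[ u ] u ∈ x × ξ ≡ j u))

  codes-functional : ∀ E c x y → Codes E c x → Codes E c y → x ≡ y
  codes-functional E c x y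
    (t  , j  , tr  , x⊆t  , inj  , specE  , specc )
    (t′ , j′ , tr′ , y⊆t′ , inj′ , specE′ , specc′) =
    extensionality x y λ z → mk⇔ (there z) (back z)
    where
    same : ∀ u → Acc _∈_ u → ∀ u′ → u ∈ t → u′ ∈ t′ → j u ≡ j′ u′ → u ≡ u′
    same u (acc rs) u′ u∈t u′∈t′ e =
      extensionality u u′ λ z → mk⇔ (fwd z) (bwd z)
      where
      fwd : ∀ z → z ∈ u → z ∈ u′
      fwd z z∈u
        with to (specE′ _) (from (specE (opair (j z) (j u)))
                                 (z , u , u∈t , z∈u , refl))
      ... | z′ , v′ , v′∈t′ , z′∈v′ , q with opair-injective q
      ...   | jz≡ , ju≡
        with inj′ u′ v′ u′∈t′ v′∈t′ (trans (sym e) ju≡)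
      ...     | refl
        with same z (rs z∈u) z′ (tr u u∈t z z∈u) (tr′ v′ v′∈t′ z′ z′∈v′) jz≡
      ...       | refl = z′∈v′

      bwd : ∀ z → z ∈ u′ → z ∈ u
      bwd z′ z′∈u′
        with to (specE _) (from (specE′ (opair (j′ z′) (j′ u′)))
                                (z′ , u′ , u′∈t′ , z′∈u′ , refl))
      ... | z , v , v∈t , z∈v , q with opair-injective q
      ...   | jz≡ , ju≡
        with inj u v u∈t v∈t (trans e ju≡)
      ...     | refl
        with same z (rs z∈v) z′ (tr v v∈t z z∈v) (tr′ u′ u′∈t′ z′ z′∈u′) (sym jz≡)
      ...       | refl = z∈v

    there : ∀ z → z ∈ x → z ∈ y
    there z z∈x with to (specc′ _) (from (specc (j z)) (z , z∈x , refl))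
    ... | z′ , z′∈y , e
      with same z (foundation z) z′ (x⊆t z z∈x) (y⊆t′ z′ z′∈y) e
    ...   | refl = z′∈y

    back : ∀ z → z ∈ y → z ∈ x
    back z z∈y with to (specc _) (from (specc′ (j′ z)) (z , z∈y , refl))
    ... | z′ , z′∈x , e
      with same z′ (foundation z′) z (x⊆t z′ z′∈x) (y⊆t′ z z∈y) (sym e)
    ...   | refl = z′∈x

  module _ (θ : V) where

    upair∈℘ : ∀ {a b s} → a ∈ s → b ∈ s → upair a b ∈ ℘ s
    upair∈℘ {a} {b} {s} a∈s b∈s = from (proj₂ (powerset s) _) sub
      where
      sub : upair a b ⊆ s
      sub z z∈ with to (∈-upair a b) z∈
      ... | inj₁ refl = a∈s
      ... | inj₂ refl = b∈s

    decode : V → V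
    decode E = proj₁ (replacement (Codes E) (℘ θ) λ c _ → codes-functional E c)

    decoded : V
    decoded = ⋃ (proj₁ (replacement (λ E s → s ≡ decode E) (℘ (℘ (℘ θ)))
                                    λ _ _ _ _ p q → trans p (sym q)))

    covers : ∀ x → HereditarilySmaller θ x → x ∈ decoded
    covers x (t , (x⊆t , tr , _) , (j , maps , inj) , _) =
      from (proj₂ (union _) x)
        ( decode E
        , from (proj₂ (replacement _ _ _) _)
               (E , from (proj₂ (powerset _) E) (λ p p∈ → proj₁ (to ∈-∩ᶜ p∈)) , refl)
        , from (proj₂ (replacement _ _ _) x)
               ( c , from (proj₂ (powerset θ) c) (λ ξ ξ∈ → proj₁ (to ∈-∩ᶜ ξ∈))
               , t , j , tr , x⊆t , inj , specE , specc))
      where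
      InE : Class
      InE p = ∃[ u ] ∃[ v ] v ∈ t × u ∈ v × p ≡ opair (j u) (j v)

      E c : V
      E = ℘ (℘ θ) ∩ᶜ InE
      c = θ ∩ᶜ λ ξ → ∃[ u ] u ∈ x × ξ ≡ j u

      bound : ∀ p → InE p → p ∈ ℘ (℘ θ)
      bound p (u , v , v∈t , u∈v , refl) =
        upair∈℘ {s = ℘ θ} (upair∈℘ ju ju) (upair∈℘ ju (maps v v∈t))
        where ju = maps u (tr v v∈t u u∈v)

      specE : ∀ p → p ∈ E ⇔ InE p
      specE p = mk⇔ (λ p∈ → proj₂ (to ∈-∩ᶜ p∈)) (λ q → from ∈-∩ᶜ (bound p q , q))

      specc : ∀ ξ → ξ ∈ c ⇔ (∃[ u ] u ∈ x × ξ ≡ j u)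
      specc ξ = mk⇔ (λ ξ∈ → proj₂ (to ∈-∩ᶜ ξ∈))
        λ { (u , u∈x , refl) → from ∈-∩ᶜ (maps u (x⊆t u u∈x) , u , u∈x , refl) }

  H-exists : ∀ θ → ∃[ h ] ∀ x → x ∈ h ⇔ HereditarilySmaller θ x
  H-exists θ = (decoded θ ∩ᶜ HereditarilySmaller θ) , λ x →
    mk⇔ (λ x∈ → proj₂ (Equivalence.to ∈-∩ᶜ x∈))
        (λ hx → Equivalence.from ∈-∩ᶜ (covers θ x hx , hx))

  H : V → V
  H θ = proj₁ (H-exists θ)

  -- First-order structures and elementary substructures.  The
  -- interpretations are defined on all of V, but only their restrictions
  -- to the universe A matter.

  record Structure (L : Language) (A : V) : Set (suc ℓ) where
    field
      funI   : (f : Fun L) → Vec V (funArity L f) → V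
      closed : ∀ f xs → All (_∈ A) xs → funI f xs ∈ A
      relI   : (r : Rel L) → Vec V (relArity L r) → Set ℓ

  module _ {L : Language} {A : V} (𝔄 : Structure L A) where
    open Structure 𝔄

    mutual
      eval : ∀ {n} → Vec V n → Term L n → V
      eval ρ (var i)    = lookup ρ i
      eval ρ (fun f ts) = funI f (evals ρ ts)

      evals : ∀ {n k} → Vec V n → Vec (Term L n) k → Vec V k
      evals ρ []       = []
      evals ρ (t ∷ ts) = eval ρ t ∷ evals ρ ts

    -- Satisfaction in the restriction of 𝔄 to D.
    Sat : V → ∀ {n} → Formula L n → Vec V n → Set ℓ
    Sat D (s ≐ t)    ρ = eval ρ s ≡ eval ρ t
    Sat D (rel r ts) ρ = relI r (evals ρ ts)
    Sat D ⊥̇          ρ = ⊥ₚ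
    Sat D (φ ⇒̇ ψ)    ρ = Sat D φ ρ → Sat D ψ ρ
    Sat D (∀̇ φ)      ρ = ∀ x → x ∈ D → Sat D φ (x ∷ ρ)

  _≺ᵉ_ : ∀ {L A} → V → Structure L A → Set ℓ
  _≺ᵉ_ {L} {A} M 𝔄 =
      M ⊆ A
    × (∀ f xs → All (_∈ M) xs → Structure.funI 𝔄 f xs ∈ M)
    × (∀ {n} (φ : Formula L n) ρ → All (_∈ M) ρ → Sat 𝔄 M φ ρ ⇔ Sat 𝔄 A φ ρ)

  ⟨_,∈⟩ : ∀ A → Structure L∈ A
  ⟨ A ,∈⟩ = record
    { funI   = λ ()
    ; closed = λ ()
    ; relI   = λ { _ (x ∷ y ∷ []) → x ∈ y }
    }

  Stationary : V → V → Set (suc ℓ)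
  Stationary A S = ∀ L → Countable L → (𝔄 : Structure L A) →
                   ∃[ M ] M ∈ S × M ≺ᵉ 𝔄

  -- σ : T → X is the inverse of the Mostowski collapse of X.
  record IsInverseCollapse (X T : V) (σ : V → V) : Set ℓ where
    field
      transitive : Transitive T
      maps       : Maps σ T X
      injective  : InjectiveOn T σ
      surjective : ∀ x → x ∈ X → ∃[ y ] y ∈ T × σ y ≡ x
      ∈-iso      : ∀ y z → y ∈ T → z ∈ T → y ∈ z ⇔ σ y ∈ σ z

  -- σ_X⁻¹(b) = c, where σ_X : H_X → X.
  CollapsesTo : V → V → V → Set ℓ
  CollapsesTo X b c = ∃[ T ] ∃[ σ ] IsInverseCollapse X T σ × c ∈ T × σ c ≡ b

  collapse-unique : ∀ {X b c c′} → CollapsesTo X b c → CollapsesTo X b c′ → c ≡ c′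
  collapse-unique {X} (T , σ , i , c∈T , σc≡b) (T′ , σ′ , i′ , c′∈T′ , σ′c′≡b) =
    same i i′ _ (foundation _) _ c∈T c′∈T′ (trans σc≡b (sym σ′c′≡b))
    where
    open IsInverseCollapse
    open Equivalence using (to; from)

    same : ∀ {T σ T′ σ′} → IsInverseCollapse X T σ → IsInverseCollapse X T′ σ′ →
           ∀ y → Acc _∈_ y → ∀ y′ → y ∈ T → y′ ∈ T′ → σ y ≡ σ′ y′ → y ≡ y′
    same {T} {σ} {T′} {σ′} i i′ y (acc rs) y′ y∈T y′∈T′ e =
      extensionality y y′ λ z → mk⇔ (fwd z) (bwd z)
      where
      fwd : ∀ z → z ∈ y → z ∈ y′
      fwd z z∈y with transitive i y y∈T z z∈y
      ... | z∈T with surjective i′ (σ z) (maps i z z∈T)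
      ...   | z′ , z′∈T′ , e′ with same i i′ z (rs z∈y) z′ z∈T z′∈T′ (sym e′)
      ...     | refl = from (∈-iso i′ z y′ z′∈T′ y′∈T′)
                         (subst (_∈ σ′ y′) (sym e′)
                           (subst (σ z ∈_) e (to (∈-iso i z y z∈T y∈T) z∈y)))

      bwd : ∀ z → z ∈ y′ → z ∈ y
      bwd z′ z′∈y′ with transitive i′ y′ y′∈T′ z′ z′∈y′
      ... | z′∈T′ with surjective i (σ′ z′) (maps i′ z′ z′∈T′)
      ...   | z , z∈T , e′ = subst (_∈ y) (same i i′ z (rs z∈y) z′ z∈T z′∈T′ e′) z∈y
        where
        z∈y : z ∈ y
        z∈y = from (∈-iso i z y z∈T y∈T)
                (subst (_∈ σ y) (sym e′)
                  (subst (σ′ z′ ∈_) (sym e) (to (∈-iso i′ z′ y′ z′∈T′ y′∈T′) z′∈y′)))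

  -- G _≡_ κ F b θ is G^{b,θ}_{=F} and G _∈_ κ F b θ is G^{b,θ}_{∈F}.
  G : (V → V → Set ℓ) → V → (V → V) → V → V → V
  G _∼_ κ F b θ = ℘ (H θ) ∩ᶜ λ M →
      (b ∈ M × M ≺ᵉ ⟨ H θ ,∈⟩)
    × (M ∩ κ) ∈ κ
    × (∃[ c ] CollapsesTo M b c × c ∼ F (M ∩ κ))

  ForSufficientlyLargeRegular : (V → Set (suc ℓ)) → Set (suc ℓ)
  ForSufficientlyLargeRegular P =
    ∃[ θ₀ ] Ordinal θ₀ × (∀ θ → RegularUncountable θ → θ₀ ∈ θ → P θ)

  Is◇Lav-function : V → Class → (V → V) → Set (suc ℓ)
  Is◇Lav-function κ Γ F =
    ∀ b → ForSufficientlyLargeRegular λ θ → Stationary (H θ) (G _≡_ κ F b θ ∩ᶜ Γ)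

  Is◇⁻Lav-function : V → Class → (V → V) → Set (suc ℓ)
  Is◇⁻Lav-function κ Γ F =
      (∀ b → ForSufficientlyLargeRegular λ θ → Stationary (H θ) (G _∈_ κ F b θ ∩ᶜ Γ))
    × (∀ α → α ∈ κ → F α ≼ α)

  ◇Lav : V → Class → Set (suc ℓ)
  ◇Lav κ Γ = ∃[ F ] Is◇Lav-function κ Γ F

  ◇⁻Lav : V → Class → Set (suc ℓ)
  ◇⁻Lav κ Γ = ∃[ F ] Is◇⁻Lav-function κ Γ F

  ProjectsDownward : Class → Set ℓ
  ProjectsDownward Γ = ∀ X θ → Γ X → RegularUncountable θ →
                       θ ≤ᵒ sup (X ∩ᶜ Ordinal) → Γ (X ∩ H θ)

{-# OPTIONS --safe #-}

-- A ◇Lav function F yields the ◇⁻Lav function sending α ≠ 0 to {F(α)} and 0 to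
-- the empty set, since M ∩ κ ≠ 0 for elementary M.  Conversely let F be
-- a ◇⁻Lav function, index F(α) by ordinals below α, and let F_ξ(α) be the value
-- at ξ of the ξ-th element of F(α).  If no F_ξ is a ◇Lav function, choose b_ξ,
-- θ_ξ and a structure 𝔄_ξ on H(θ_ξ) witnessing this.  For θ large let M be
-- closed under Skolem functions of the 𝔄_ξ and of the (H(θ_ξ), ∈), uniformly
-- in ξ, such that the collapse of ⟨b_ξ : ξ < κ⟩ is in F(M ∩ κ), say with index
-- ξ.  As ξ < M ∩ κ is not moved by the collapse, F_ξ(M ∩ κ) is the collapse
-- of b_ξ, so M ∩ H(θ_ξ) contradicts the choice of 𝔄_ξ.  Formulas are coded by
-- finite binary trees in V, so that one Skolem function with arguments ξ, a
-- formula code and a tuple serves all the languages at once.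

module Submission where

open import Defs
open import Level using (Level; suc; Lift; lift; lower)
open import Axiom.ExcludedMiddle using (ExcludedMiddle)
open import Data.Empty using (⊥; ⊥-elim)
open import Data.Empty.Polymorphic using () renaming (⊥ to ⊥ₚ; ⊥-elim to ⊥ₚ-elim)
open import Data.Fin using (Fin; zero; toℕ; #_) renaming (suc to fsuc)
open import Data.Fin.Properties using (toℕ-injective)
open import Data.Nat using (ℕ; zero; _+_; _≤′_; ≤′-refl; ≤′-step) renaming (suc to 1+)
open import Data.Nat.Properties using (<-cmp; m≤m+n; m≤n+m; ≤⇒≤′)
open import Data.Product using (∃; ∃-syntax; _×_; _,_; proj₁; proj₂)
open import Data.Sum using (_⊎_; inj₁; inj₂; [_,_]′)
open import Data.Unit using (tt)
open import Data.Vec using (Vec; []; _∷_; lookup; map; allFin)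
open import Data.Vec.Properties using (map-lookup-allFin; map-∘)
open import Data.Vec.Relation.Unary.All using (All; []; _∷_) renaming (map to mapAll)
open import Data.Vec.Relation.Unary.All.Properties using (lookup⁺; lookup⁻)
open import Function.Base using (_∘_; id)
open import Function.Bundles using (_⇔_; mk⇔; mk↣; module Equivalence; module Injection)
open import Induction.WellFounded
  using (Acc; acc; module FixPoint; wf⇒asym) renaming (module All to WfAll)
open import Relation.Binary.Definitions using (tri<; tri≈; tri>)
open import Relation.Binary.PropositionalEquality
  using (_≡_; _≢_; refl; sym; trans; cong; cong₂; subst)
open import Relation.Nullary using (¬_; Dec; yes; no)
open import Relation.Nullary.Decidable using (map′; decidable-stable)

open Equivalence using (to; from)

-- Coding formulas by finite binary trees

data Tree : Set where
  leaf : Tree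
  node : Tree → Tree → Tree

nat : ℕ → Tree
nat zero   = leaf
nat (1+ n) = node leaf (nat n)

nat-injective : ∀ m n → nat m ≡ nat n → m ≡ n
nat-injective zero   zero   _ = refl
nat-injective (1+ m) (1+ n) e = cong 1+ (nat-injective m n (right e))
  where
  right : ∀ {a b c d} → node a b ≡ node c d → b ≡ d
  right refl = refl

-- Relations rather than functions to trees: injectivity then needs no
-- clauses for distinct constructors.
module SyntaxCode {L : Language} (countable : Countable L) where

  open Injection (proj₁ countable) using () renaming (to to #fun; injective to #fun-injective)
  open Injection (proj₂ countable) using () renaming (to to #rel; injective to #rel-injective)

  mutual
    data TermCode {n : ℕ} : Term L n → Tree → Set where
      -- The number is given by an equation, as `nat (toℕ i)` in the index would block matching two
      -- codes of one tree. The left subtree tells variables (a leaf) from applications (a node).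
      var : ∀ {i a} → a ≡ nat (toℕ i) → TermCode (var i) (node leaf a)
      fun : ∀ {f ts a b} → a ≡ nat (#fun f) → TermsCode ts b →
            TermCode (fun f ts) (node (node leaf a) b)

    data TermsCode {n : ℕ} : ∀ {k} → Vec (Term L n) k → Tree → Set where
      []  : TermsCode [] leaf
      _∷_ : ∀ {k t a b} {ts : Vec (Term L n) k} →
            TermCode t a → TermsCode ts b → TermsCode (t ∷ ts) (node a b)

  data FormulaCode : ∀ {n} → Formula L n → Tree → Set where
    _≐_ : ∀ {n a b} {s t : Term L n} → TermCode s a → TermCode t b →
          FormulaCode (s ≐ t) (node (nat 0) (node a b))
    rel : ∀ {n r a b} {ts : Vec (Term L n) _} → a ≡ nat (#rel r) → TermsCode ts b →
          FormulaCode (rel r ts) (node (nat 1) (node a b))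
    ⊥̇   : ∀ {n} → FormulaCode (⊥̇ {n = n}) (node (nat 2) leaf)
    _⇒̇_ : ∀ {n a b} {φ ψ : Formula L n} → FormulaCode φ a → FormulaCode ψ b →
          FormulaCode (φ ⇒̇ ψ) (node (nat 3) (node a b))
    ∀̇   : ∀ {n a} {φ : Formula L (1+ n)} → FormulaCode φ a →
          FormulaCode (∀̇ φ) (node (nat 4) a)

  mutual
    termCode : ∀ {n} (t : Term L n) → ∃ (TermCode t)
    termCode (var i)    = _ , var refl
    termCode (fun f ts) = _ , fun refl (proj₂ (termsCode ts))

    termsCode : ∀ {n k} (ts : Vec (Term L n) k) → ∃ (TermsCode ts)
    termsCode []       = _ , []
    termsCode (t ∷ ts) = _ , proj₂ (termCode t) ∷ proj₂ (termsCode ts)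

  formulaCode : ∀ {n} (φ : Formula L n) → ∃ (FormulaCode φ)
  formulaCode (s ≐ t)    = _ , proj₂ (termCode s) ≐ proj₂ (termCode t)
  formulaCode (rel r ts) = _ , rel refl (proj₂ (termsCode ts))
  formulaCode ⊥̇          = _ , ⊥̇
  formulaCode (φ ⇒̇ ψ)    = _ , proj₂ (formulaCode φ) ⇒̇ proj₂ (formulaCode ψ)
  formulaCode (∀̇ φ)      = _ , ∀̇ (proj₂ (formulaCode φ))

  mutual
    termCode-injective : ∀ {n a} {s t : Term L n} → TermCode s a → TermCode t a → s ≡ t
    termCode-injective (var p) (var q) =
      cong var (toℕ-injective (nat-injective _ _ (trans (sym p) q)))
    termCode-injective (fun p x) (fun q y)
      with refl ← #fun-injective (nat-injective _ _ (trans (sym p) q)) =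
      cong (fun _) (termsCode-injective x y)

    termsCode-injective : ∀ {n k a} {ss ts : Vec (Term L n) k} →
                          TermsCode ss a → TermsCode ts a → ss ≡ ts
    termsCode-injective []       []       = refl
    termsCode-injective (x ∷ xs) (y ∷ ys) =
      cong₂ _∷_ (termCode-injective x y) (termsCode-injective xs ys)

  -- The tree does not record `n`: `⊥̇` has one code for all `n`. For this reason `Counterexample`
  -- pairs the tree with `nat n`.
  formulaCode-injective : ∀ {n a} {φ ψ : Formula L n} →
                          FormulaCode φ a → FormulaCode ψ a → φ ≡ ψ
  formulaCode-injective (x ≐ y) (x′ ≐ y′) =
    cong₂ _≐_ (termCode-injective x x′) (termCode-injective y y′)
  formulaCode-injective (rel p x) (rel q y)
    with refl ← #rel-injective (nat-injective _ _ (trans (sym p) q)) =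
    cong (rel _) (termsCode-injective x y)
  formulaCode-injective ⊥̇ ⊥̇ = refl
  formulaCode-injective (x ⇒̇ y) (x′ ⇒̇ y′) =
    cong₂ _⇒̇_ (formulaCode-injective x x′) (formulaCode-injective y y′)
  formulaCode-injective (∀̇ x) (∀̇ y) = cong ∀̇ (formulaCode-injective x y)

module Classical {ℓ : Level} (em : ExcludedMiddle (suc ℓ)) (𝕍 : ZFC ℓ) where

  open SetTheory 𝕍

  -- Classical choice and basic set operations

  em₀ : ExcludedMiddle ℓ
  em₀ {P} = map′ lower lift (em {Lift (suc ℓ) P})

  by-contradiction : {P : Set ℓ} → ¬ ¬ P → P
  by-contradiction = decidable-stable em₀

  ∅ : V
  ∅ = proj₁ infinity ∩ᶜ λ _ → ⊥ₚ

  ∉∅ : ∀ x → ¬ x ∈ ∅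
  ∉∅ x x∈∅ = ⊥ₚ-elim (proj₂ (to ∈-∩ᶜ x∈∅))

  witness : {P : Class} → Dec (∃ P) → V
  witness (yes (x , _)) = x
  witness (no _)        = ∅

  -- Hilbert's ε operator: deciding the Σ-type `∃ P` yields an actual witness, and `∅` is the value
  -- when there is none.
  ε : Class → V
  ε P = witness (em₀ {∃ P})

  ε-spec : ∀ {P : Class} → ∃ P → P (ε P)
  ε-spec {P} p with em₀ {∃ P}
  ... | yes (_ , px) = px
  ... | no ¬p        = ⊥-elim (¬p p)

  if_then_else_ : Set ℓ → V → V → V
  if P then x else y with em₀ {P}
  ... | yes _ = x
  ... | no _  = y

  if-true : ∀ {P x y} → P → (if P then x else y) ≡ x
  if-true {P} p with em₀ {P}
  ... | yes _ = refl
  ... | no ¬p = ⊥-elim (¬p p)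

  if-false : ∀ {P x y} → ¬ P → (if P then x else y) ≡ y
  if-false {P} ¬p with em₀ {P}
  ... | yes p = ⊥-elim (¬p p)
  ... | no _  = refl

  ∈-asym : ∀ {x y} → x ∈ y → ¬ y ∈ x
  ∈-asym = wf⇒asym foundation

  ∈-irrefl : ∀ {x} → ¬ x ∈ x
  ∈-irrefl x∈x = ∈-asym x∈x x∈x

  ⊆-antisym : ∀ {a b} → a ⊆ b → b ⊆ a → a ≡ b
  ⊆-antisym a⊆b b⊆a = extensionality _ _ λ x → mk⇔ (a⊆b x) (b⊆a x)

  ∈-℘ : ∀ {a x} → x ∈ ℘ a ⇔ x ⊆ a
  ∈-℘ {a} {x} = proj₂ (powerset a) x

  ∈-⋃ : ∀ {a x} → x ∈ ⋃ a ⇔ (∃[ y ] y ∈ a × x ∈ y)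
  ∈-⋃ {a} {x} = proj₂ (union a) x

  image : (V → V) → V → V
  image f a = proj₁ (replacement (λ x y → y ≡ f x) a λ _ _ _ _ p q → trans p (sym q))

  ∈-image : ∀ {f a y} → y ∈ image f a ⇔ (∃[ x ] x ∈ a × y ≡ f x)
  ∈-image {f} {a} {y} =
    proj₂ (replacement (λ x y → y ≡ f x) a λ _ _ _ _ p q → trans p (sym q)) y

  infixr 6 _∪_

  _∪_ : V → V → V
  a ∪ b = ⋃ (upair a b)

  ∪ˡ : ∀ {a b} → a ⊆ (a ∪ b)
  ∪ˡ {a} {b} x x∈a = from ∈-⋃ (a , left∈ a b , x∈a)

  ∪ʳ : ∀ {a b} → b ⊆ (a ∪ b)
  ∪ʳ {a} {b} x x∈b = from ∈-⋃ (b , right∈ a b , x∈b)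

  ∪⁻ : ∀ {a b x} → x ∈ (a ∪ b) → x ∈ a ⊎ x ∈ b
  ∪⁻ {a} {b} x∈ with to ∈-⋃ x∈
  ... | y , y∈ , x∈y with to (∈-upair a b) y∈
  ...   | inj₁ refl = inj₁ x∈y
  ...   | inj₂ refl = inj₂ x∈y

  singleton : V → V
  singleton a = upair a a

  ∈-singleton : ∀ {a x} → x ∈ singleton a → x ≡ a
  ∈-singleton {a} x∈ = [ id , id ]′ (to (∈-upair a a) x∈)

  succ : V → V
  succ a = a ∪ singleton a

  self∈succ : ∀ {a} → a ∈ succ a
  self∈succ {a} = ∪ʳ a (left∈ a a)

  ∈-succ : ∀ {a x} → x ∈ succ a → x ≤ᵒ a
  ∈-succ x∈ with ∪⁻ x∈
  ... | inj₁ x∈a = inj₁ x∈a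
  ... | inj₂ x∈s = inj₂ (∈-singleton x∈s)

  opair≢∅ : ∀ {a b} → opair a b ≢ ∅
  opair≢∅ {a} {b} e = ∉∅ _ (subst (singleton a ∈_) e (left∈ _ _))

  -- Cardinality

  ⊆⇒≼ : ∀ {a b} → a ⊆ b → a ≼ b
  ⊆⇒≼ a⊆b = id , a⊆b , λ _ _ _ _ e → e

  ≼-trans : ∀ {a b c} → a ≼ b → b ≼ c → a ≼ c
  ≼-trans (f , fm , fi) (g , gm , gi) =
    g ∘ f , (λ x x∈a → gm (f x) (fm x x∈a)) ,
    λ x y x∈a y∈a e → fi x y x∈a y∈a (gi _ _ (fm x x∈a) (fm y y∈a) e)

  ≼-≺-trans : ∀ {a b c} → a ≼ b → b ≺ c → a ≺ c
  ≼-≺-trans a≼b (b≼c , c⋠b) = ≼-trans a≼b b≼c , λ c≼a → c⋠b (≼-trans c≼a a≼b)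

  embedding-from : ∀ {a b} → Dec (a ≼ b) → V → V
  embedding-from (yes (f , _)) = f
  embedding-from (no _)        = id

  embedding : V → V → V → V
  embedding a b = embedding-from (em₀ {a ≼ b})

  embedding-spec : ∀ {a b} → a ≼ b → Maps (embedding a b) a b × InjectiveOn a (embedding a b)
  embedding-spec {a} {b} a≼b with em₀ {a ≼ b}
  ... | yes (_ , f-spec) = f-spec
  ... | no a⋠b           = ⊥-elim (a⋠b a≼b)

  -- Diagonal argument: `d` collects the values `f s` that lie outside `s`, and injectivity turns
  -- `f d ∈ d` into `f d ∉ d`.
  cantor : ∀ {a} → ¬ ℘ a ≼ a
  cantor {a} (f , maps , inj) = d∉ (from ∈-∩ᶜ (maps d d∈℘ , d , d∈℘ , refl , d∉))
    where
    d : V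
    d = a ∩ᶜ λ x → ∃[ s ] s ∈ ℘ a × f s ≡ x × ¬ x ∈ s

    d∈℘ : d ∈ ℘ a
    d∈℘ = from ∈-℘ λ x x∈d → proj₁ (to ∈-∩ᶜ x∈d)

    d∉ : ¬ f d ∈ d
    d∉ fd∈d with proj₂ (to ∈-∩ᶜ fd∈d)
    ... | s , s∈ , e , fd∉s = fd∉s (subst (f d ∈_) (inj d s d∈℘ s∈ (sym e)) fd∈d)

  -- Ordinals

  ∈-ordinal : ∀ {α β} → Ordinal α → β ∈ α → Ordinal β
  ∈-ordinal (tr , trs) β∈α = trs _ β∈α , λ x x∈β → trs x (tr _ β∈α x x∈β)

  Comparable : V → V → Set ℓ
  Comparable α β = α ∈ β ⊎ α ≡ β ⊎ β ∈ α

  -- Induction on both ordinals: if some `γ` in `α` is not in `β`, comparing `γ` with `β` leaves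
  -- `β ≤ᵒ γ`, hence `β ∈ α`; the other case is symmetric.
  comparable : ∀ {α β} → Ordinal α → Ordinal β → Comparable α β
  comparable = go (foundation _) (foundation _)
    where
    go : ∀ {α β} → Acc _∈_ α → Acc _∈_ β → Ordinal α → Ordinal β → Comparable α β
    go {α} {β} (acc rα) (acc rβ) oα oβ
      with em₀ {∃[ γ ] γ ∈ α × ¬ γ ∈ β} | em₀ {∃[ γ ] γ ∈ β × ¬ γ ∈ α}
    ... | no α⊆β | no β⊆α = inj₂ (inj₁ (⊆-antisym
      (λ x x∈α → by-contradiction λ x∉β → α⊆β (x , x∈α , x∉β))
      (λ x x∈β → by-contradiction λ x∉α → β⊆α (x , x∈β , x∉α))))
    ... | yes (γ , γ∈α , γ∉β) | _
      with go (rα γ∈α) (acc rβ) (∈-ordinal oα γ∈α) oβ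
    ...   | inj₁ γ∈β         = ⊥-elim (γ∉β γ∈β)
    ...   | inj₂ (inj₁ refl) = inj₂ (inj₂ γ∈α)
    ...   | inj₂ (inj₂ β∈γ)  = inj₂ (inj₂ (proj₁ oα γ γ∈α β β∈γ))
    go {α} {β} (acc rα) (acc rβ) oα oβ | no _ | yes (γ , γ∈β , γ∉α)
      with go (acc rα) (rβ γ∈β) oα (∈-ordinal oβ γ∈β)
    ...   | inj₁ α∈γ         = inj₁ (proj₁ oβ γ γ∈β α α∈γ)
    ...   | inj₂ (inj₁ refl) = inj₁ γ∈β
    ...   | inj₂ (inj₂ γ∈α)  = ⊥-elim (γ∉α γ∈α)

  succ-ordinal : ∀ {α} → Ordinal α → Ordinal (succ α)
  succ-ordinal {α} (tr , trs) =
    (λ x x∈ y y∈x → ∪ˡ y ([ (λ x∈α → tr x x∈α y y∈x) , (λ { refl → y∈x }) ]′ (∈-succ x∈))) ,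
    λ x x∈ → [ trs x , (λ { refl → tr }) ]′ (∈-succ x∈)

  ∪-ordinal : ∀ {α β} → Ordinal α → Ordinal β → Ordinal (α ∪ β)
  ∪-ordinal (trα , trsα) (trβ , trsβ) =
    (λ x x∈ y y∈x → [ (λ x∈α → ∪ˡ y (trα x x∈α y y∈x))
                     , (λ x∈β → ∪ʳ y (trβ x x∈β y y∈x)) ]′ (∪⁻ x∈)) ,
    λ x x∈ → [ trsα x , trsβ x ]′ (∪⁻ x∈)

  -- H_θ

  transitive-closure-within : ∀ {x s} → x ⊆ s → Transitive s →
                              ∃[ t ] IsTransitiveClosure x t × t ⊆ s
  transitive-closure-within {x} {s} x⊆s tr-s =
    t ,
    ( (λ y y∈x → from ∈-∩ᶜ (x⊆s y y∈x , λ s′ x⊆s′ _ → x⊆s′ y y∈x))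
    , (λ y y∈t z z∈y → from ∈-∩ᶜ
        ( tr-s y (proj₁ (to ∈-∩ᶜ y∈t)) z z∈y
        , λ s′ x⊆s′ tr → tr y (proj₂ (to ∈-∩ᶜ y∈t) s′ x⊆s′ tr) z z∈y))
    , λ s′ x⊆s′ tr y y∈t → proj₂ (to ∈-∩ᶜ y∈t) s′ x⊆s′ tr) ,
    λ y y∈t → proj₁ (to ∈-∩ᶜ y∈t)
    where
    t : V
    t = s ∩ᶜ λ y → ∀ s′ → x ⊆ s′ → Transitive s′ → y ∈ s′

  -- By ∈-induction the elements of `x` have closures; their union together with `x` is a transitive
  -- superset from which the least one is separated.
  transitive-closure : ∀ x → ∃[ t ] IsTransitiveClosure x t
  transitive-closure x = go x (foundation x)
    where
    go : ∀ x → Acc _∈_ x → ∃[ t ] IsTransitiveClosure x t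
    go x (acc rs) =
      let t , tc , _ = transitive-closure-within {x} {x ∪ ⋃ ts} ∪ˡ tr in t , tc
      where
      unique : ∀ y → y ∈ x → ∀ t t′ →
               IsTransitiveClosure y t → IsTransitiveClosure y t′ → t ≡ t′
      unique _ _ t t′ (y⊆t , tr , min) (y⊆t′ , tr′ , min′) =
        ⊆-antisym (min t′ y⊆t′ tr′) (min′ t y⊆t tr)

      r : ∃[ b ] ∀ t → t ∈ b ⇔ (∃[ y ] y ∈ x × IsTransitiveClosure y t)
      r = replacement IsTransitiveClosure x unique

      ts : V
      ts = proj₁ r

      tr : Transitive (x ∪ ⋃ ts)
      tr y y∈ z z∈y with ∪⁻ y∈
      ... | inj₁ y∈x =
        let t , tc = go y (rs y∈x)
        in ∪ʳ z (from ∈-⋃ (t , from (proj₂ r t) (y , y∈x , tc) , proj₁ tc z z∈y))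
      ... | inj₂ y∈⋃ with to ∈-⋃ y∈⋃
      ...   | t , t∈ts , y∈t with to (proj₂ r t) t∈ts
      ...     | _ , _ , (_ , tr-t , _) = ∪ʳ z (from ∈-⋃ (t , t∈ts , tr-t y y∈t z z∈y))

  -- The transitive closure of `x` lies inside `t`, so any small transitive superset will do.
  H-intro : ∀ {θ x t} → x ⊆ t → Transitive t → t ≺ θ → x ∈ H θ
  H-intro {θ} {x} x⊆t tr t≺θ =
    let s , tc , s⊆t = transitive-closure-within x⊆t tr
    in from (proj₂ (H-exists θ) x) (s , tc , ≼-≺-trans (⊆⇒≼ s⊆t) t≺θ)

  H-transitive : ∀ {θ} → Transitive (H θ)
  H-transitive {θ} x x∈H y y∈x with to (proj₂ (H-exists θ) x) x∈H
  ... | t , (x⊆t , tr , _) , t≺θ = H-intro (tr y (x⊆t y y∈x)) tr t≺θ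

  transitive⊆H : ∀ {θ d} → Transitive d → d ≺ θ → d ⊆ H θ
  transitive⊆H tr d≺θ x x∈d = H-intro (tr x x∈d) tr d≺θ

  cardinal⊆H : ∀ {θ} → Cardinal θ → θ ⊆ H θ
  cardinal⊆H {θ} ((_ , trs) , small) α α∈θ = H-intro (λ _ → id) (trs α α∈θ) (small α α∈θ)

  -- Hartogs numbers and the well-ordering theorem

  -- An ordinal embedding in a has a smaller size than ℘ a by Cantor's theorem.
  ℵ : V → V
  ℵ a = H (℘ a) ∩ᶜ λ α → Ordinal α × α ≼ a

  ∈-ℵ : ∀ {a α} → α ∈ ℵ a ⇔ (Ordinal α × α ≼ a)
  ∈-ℵ {a} {α} = mk⇔ (λ α∈ → proj₂ (to ∈-∩ᶜ α∈))
    λ { (oα , α≼a) → from ∈-∩ᶜ (H-intro (λ _ → id) (proj₁ oα) (≼-≺-trans α≼a a≺℘a) , oα , α≼a) }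
    where
    a≺℘a : a ≺ ℘ a
    a≺℘a = ( singleton
           , (λ x x∈a → from ∈-℘ λ y y∈ → subst (_∈ a) (sym (∈-singleton y∈)) x∈a)
           , λ x y _ _ e → ∈-singleton (subst (x ∈_) e (left∈ x x))) , cantor

  ℵ-ordinal : ∀ {a} → Ordinal (ℵ a)
  ℵ-ordinal =
    (λ α α∈ β β∈α →
      let oα , α≼a = to ∈-ℵ α∈
      in from ∈-ℵ (∈-ordinal oα β∈α , ≼-trans (⊆⇒≼ (proj₁ oα β β∈α)) α≼a)) ,
    λ α α∈ → proj₁ (proj₁ (to ∈-ℵ α∈))

  -- Hartogs' theorem, by the Burali-Forti argument: otherwise `ℵ a` would be an element of itself.
  ℵ⋠ : ∀ {a} → ¬ ℵ a ≼ a
  ℵ⋠ ℵ≼a = ∈-irrefl (from ∈-ℵ (ℵ-ordinal , ℵ≼a))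

  ℵ-cardinal : ∀ {a} → Cardinal (ℵ a)
  ℵ-cardinal = ℵ-ordinal , λ α α∈ →
    ⊆⇒≼ (proj₁ ℵ-ordinal α α∈) , λ ℵ≼α → ℵ⋠ (≼-trans ℵ≼α (proj₂ (to ∈-ℵ α∈)))

  -- Enumerate a by recursion, choosing at each stage an element not chosen
  -- before; Hartogs' theorem stops the enumeration.
  module Enumeration (a : V) where

    unused : ∀ x → (∀ {y} → y ∈ x → V) → V
    unused x f = a ∩ᶜ λ z → ∀ y (y∈x : y ∈ x) → ¬ f y∈x ≡ z

    -- Choosing from a set makes the choice extensional: equivalent predicates may have different
    -- `ε`, but sets with the same elements are equal.
    choose : V → V
    choose s = ε (_∈ s)

    unused-ext : ∀ x {f g : ∀ {y} → y ∈ x → V} → (∀ {y} (y∈x : y ∈ x) → f y∈x ≡ g y∈x) →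
                 choose (unused x f) ≡ choose (unused x g)
    unused-ext x e = cong choose (⊆-antisym
      (λ z z∈ → let z∈a , new = to ∈-∩ᶜ z∈
                in from ∈-∩ᶜ (z∈a , λ y y∈x q → new y y∈x (trans (e y∈x) q)))
      (λ z z∈ → let z∈a , new = to ∈-∩ᶜ z∈
                in from ∈-∩ᶜ (z∈a , λ y y∈x q → new y y∈x (trans (sym (e y∈x)) q))))

    open FixPoint foundation (λ _ → V) (λ x f → choose (unused x f)) unused-ext
    open WfAll foundation ℓ using (wfRec)

    enum : V → V
    enum = wfRec (λ _ → V) (λ x f → choose (unused x f))

    Unused : V → V → Set ℓ
    Unused α z = z ∈ a × (∀ β → β ∈ α → enum β ≢ z)

    enum-spec : ∀ {α} → ∃ (Unused α) → Unused α (enum α)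
    enum-spec {α} (z , z∈a , new)
      = subst (Unused α) (sym unfold-wfRec)
          (to ∈-∩ᶜ (ε-spec (z , from ∈-∩ᶜ (z∈a , new))))

    embeds-in-ordinal : ∃[ α ] Ordinal α × a ≼ α
    embeds-in-ordinal with em₀ {∃[ α ] α ∈ ℵ a × ¬ ∃ (Unused α)}
    ... | yes (α , α∈ , all-used) =
      α , proj₁ (to ∈-ℵ α∈) , index ,
      (λ z z∈a → proj₁ (index-spec z∈a)) ,
      λ x y x∈a y∈a e →
        trans (sym (proj₂ (index-spec x∈a))) (trans (cong enum e) (proj₂ (index-spec y∈a)))
      where
      index : V → V
      index z = ε λ β → β ∈ α × enum β ≡ z

      index-spec : ∀ {z} → z ∈ a → index z ∈ α × enum (index z) ≡ z
      index-spec z∈a = ε-spec (by-contradiction λ none →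
        all-used (_ , z∈a , λ β β∈α e → none (β , β∈α , e)))
    ... | no never = ⊥-elim (ℵ⋠ (enum , (λ α α∈ → proj₁ (fresh α∈)) , inj))
      where
      fresh : ∀ {α} → α ∈ ℵ a → Unused α (enum α)
      fresh α∈ = enum-spec (by-contradiction λ none → never (_ , α∈ , none))

      inj : InjectiveOn (ℵ a) enum
      inj α β α∈ β∈ e with comparable (proj₁ (to ∈-ℵ α∈)) (proj₁ (to ∈-ℵ β∈))
      ... | inj₁ α∈β        = ⊥-elim (proj₂ (fresh β∈) α α∈β e)
      ... | inj₂ (inj₁ α≡β) = α≡β
      ... | inj₂ (inj₂ β∈α) = ⊥-elim (proj₂ (fresh α∈) β β∈α (sym e))

  open Enumeration public using (embeds-in-ordinal)

  -- Regular cardinals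

  -- Kuratowski pairing then embeds `a × a` in `a`, which replaces cardinal arithmetic.
  PairClosed : V → Set ℓ
  PairClosed a = ∀ x y → x ∈ a → y ∈ a → upair x y ∈ a

  opair-closed : ∀ {a x y} → PairClosed a → x ∈ a → y ∈ a → opair x y ∈ a
  opair-closed pc x∈ y∈ = pc _ _ (pc _ _ x∈ x∈) (pc _ _ x∈ y∈)

  -- If f : α → ℵ a were cofinal, a choice of injections f(ξ) → a would
  -- embed ℵ a in a × a, hence in a.
  ℵ-regular : ∀ {a} → PairClosed a → ∅ ∈ a → ω ≼ ℵ a → Regular (ℵ a)
  ℵ-regular {a} pc ∅∈a ω≼ = ℵ-cardinal , ω≼ , bounded
    where
    ℵ-succ : ∀ {α} → α ∈ ℵ a → succ α ∈ ℵ a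
    ℵ-succ {α} α∈ with to ∈-ℵ α∈
    ... | oα , f , maps , inj = from ∈-ℵ (succ-ordinal oα , g , g-maps , g-inj)
      where
      g : V → V
      -- Ordered pairs are never empty, which leaves `∅` free as the value at `α`.
      g x = if (x ∈ α) then opair ∅ (f x) else ∅

      g-in : ∀ {x} → x ∈ α → g x ≡ opair ∅ (f x)
      g-in = if-true

      g-self : g α ≡ ∅
      g-self = if-false ∈-irrefl

      g-maps : Maps g (succ α) a
      g-maps x x∈ with ∈-succ x∈
      ... | inj₁ x∈α  = subst (_∈ a) (sym (g-in x∈α)) (opair-closed pc ∅∈a (maps x x∈α))
      ... | inj₂ refl = subst (_∈ a) (sym g-self) ∅∈a

      g-inj : InjectiveOn (succ α) g
      g-inj x y x∈ y∈ e with ∈-succ x∈ | ∈-succ y∈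
      ... | inj₁ x∈α | inj₁ y∈α =
        inj x y x∈α y∈α (proj₂ (opair-injective (trans (sym (g-in x∈α)) (trans e (g-in y∈α)))))
      ... | inj₁ x∈α  | inj₂ refl = ⊥-elim (opair≢∅ (trans (sym (g-in x∈α)) (trans e g-self)))
      ... | inj₂ refl | inj₁ y∈α  = ⊥-elim (opair≢∅ (trans (sym (g-in y∈α)) (trans (sym e) g-self)))
      ... | inj₂ refl | inj₂ refl = refl

    bounded : ∀ α (f : V → V) → α ∈ ℵ a → Maps f α (ℵ a) →
              ∃[ β ] β ∈ ℵ a × (∀ ξ → ξ ∈ α → f ξ ∈ β)
    bounded α f α∈ f-maps with to ∈-ℵ α∈
    ... | _ , i , i-maps , i-inj =
      β , from ∈-ℵ (β-ordinal , h , h-maps , h-inj) ,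
      λ ξ ξ∈α → from ∈-∩ᶜ (f-maps ξ ξ∈α , ξ , ξ∈α , self∈succ)
      where
      β : V
      -- The successors make every `f ξ` an element of `β`, so the bound is strict.
      β = ℵ a ∩ᶜ λ η → ∃[ ξ ] ξ ∈ α × η ∈ succ (f ξ)

      β-ordinal : Ordinal β
      β-ordinal =
        (λ η η∈β ζ ζ∈η →
          let η∈ , ξ , ξ∈α , η∈s = to ∈-∩ᶜ η∈β
              tr , _ = succ-ordinal (proj₁ (to ∈-ℵ (f-maps ξ ξ∈α)))
          in from ∈-∩ᶜ (proj₁ ℵ-ordinal η η∈ ζ ζ∈η , ξ , ξ∈α , tr η η∈s ζ ζ∈η)) ,
        λ η η∈β → proj₂ ℵ-ordinal η (proj₁ (to ∈-∩ᶜ η∈β))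

      block : V → V
      block η = ε λ ξ → ξ ∈ α × η ∈ succ (f ξ)

      block-spec : ∀ {η} → η ∈ β → block η ∈ α × η ∈ succ (f (block η))
      block-spec η∈β = ε-spec (proj₂ (to ∈-∩ᶜ η∈β))

      j : V → V → V
      j ξ = embedding (succ (f ξ)) a

      j-spec : ∀ {ξ} → ξ ∈ α → Maps (j ξ) (succ (f ξ)) a × InjectiveOn (succ (f ξ)) (j ξ)
      j-spec {ξ} ξ∈α = embedding-spec (proj₂ (to ∈-ℵ (ℵ-succ (f-maps ξ ξ∈α))))

      h : V → V
      h η = opair (i (block η)) (j (block η) η)

      h-maps : Maps h β a
      h-maps η η∈β =
        let b∈α , η∈s = block-spec η∈β
        in opair-closed pc (i-maps _ b∈α) (proj₁ (j-spec b∈α) η η∈s)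

      h-inj : InjectiveOn β h
      h-inj η η′ η∈β η′∈β e =
        let b∈α , η∈s = block-spec η∈β
            b′∈α , η′∈s = block-spec η′∈β
            e₁ , e₂ = opair-injective e
            b≡b′ = i-inj _ _ b∈α b′∈α e₁
        in proj₂ (j-spec b∈α) η η′ η∈s
             (subst (λ ξ → η′ ∈ succ (f ξ)) (sym b≡b′) η′∈s)
             (trans e₂ (cong (λ ξ → j ξ η′) (sym b≡b′)))

  -- The union of the iterated power sets of the transitive closure of x,
  -- indexed by a copy of ℕ inside an inductive set.
  pair-closure : ∀ x → ∃[ d ] x ⊆ d × Transitive d × PairClosed d × ∅ ∈ d
  pair-closure x with transitive-closure x
  ... | t , x⊆t , tr-t , _ = d , (λ y y∈x → stage⊆d 0 y (x⊆t y y∈x)) , tr-d , pc-d ,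
                             stage⊆d 1 ∅ (from ∈-℘ λ y y∈∅ → ⊥-elim (∉∅ y y∈∅))
    where
    stage : ℕ → V
    stage zero   = t
    stage (1+ n) = ℘ (stage n)

    stage-transitive : ∀ n → Transitive (stage n)
    stage-transitive zero   = tr-t
    stage-transitive (1+ n) y y∈ z z∈y =
      from ∈-℘ (stage-transitive n z (to ∈-℘ y∈ z z∈y))

    stage-mono : ∀ {m n} → m ≤′ n → stage m ⊆ stage n
    stage-mono ≤′-refl             _ y∈ = y∈
    stage-mono (≤′-step {n} m≤′n) y y∈ = from ∈-℘ (stage-transitive n y (stage-mono m≤′n y y∈))

    w : V
    w = proj₁ infinity

    numeral : ℕ → ∃[ v ] v ∈ w
    numeral zero = let (e , _ , e∈w) , _ = proj₂ infinity in e , e∈w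
    numeral (1+ n) =
      let v , v∈w = numeral n
          s , _ , s∈w = proj₂ (proj₂ infinity) v v∈w
      in s , s∈w

    num : ℕ → V
    num n = proj₁ (numeral n)

    num-suc : ∀ n → IsSuccessor (num n) (num (1+ n))
    num-suc n = let v , v∈w = numeral n in proj₁ (proj₂ (proj₂ (proj₂ infinity) v v∈w))

    num-mono : ∀ {m n} → 1+ m ≤′ n → num m ∈ num n
    num-mono {m} ≤′-refl             = from (num-suc m _) (inj₂ refl)
    num-mono     (≤′-step {n} m≤′n) = from (num-suc n _) (inj₁ (num-mono m≤′n))

    num-injective : ∀ m n → num m ≡ num n → m ≡ n
    num-injective m n e with <-cmp m n
    ... | tri≈ _ m≡n _ = m≡n
    ... | tri< m<n _ _ = ⊥-elim (∈-irrefl (subst (_∈ num n) e (num-mono (≤⇒≤′ m<n))))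
    ... | tri> _ _ n<m = ⊥-elim (∈-irrefl (subst (num n ∈_) e (num-mono (≤⇒≤′ n<m))))

    IsStage : V → V → Set ℓ
    IsStage v s = ∃[ n ] v ≡ num n × s ≡ stage n

    stages : ∃[ b ] ∀ s → s ∈ b ⇔ (∃[ v ] v ∈ w × IsStage v s)
    stages = replacement IsStage w λ { _ _ _ _ (m , p , refl) (n , q , refl) →
               cong stage (num-injective m n (trans (sym p) q)) }

    d : V
    d = ⋃ (proj₁ stages)

    stage⊆d : ∀ n → stage n ⊆ d
    stage⊆d n y y∈ = from ∈-⋃
      (stage n , from (proj₂ stages _) (num n , proj₂ (numeral n) , n , refl , refl) , y∈)

    d⊆stage : ∀ {y} → y ∈ d → ∃[ n ] y ∈ stage n
    d⊆stage y∈d with to ∈-⋃ y∈d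
    ... | s , s∈ , y∈s with to (proj₂ stages s) s∈
    ...   | _ , _ , n , _ , refl = n , y∈s

    tr-d : Transitive d
    tr-d y y∈d z z∈y = let n , y∈ = d⊆stage y∈d in stage⊆d n z (stage-transitive n y y∈ z z∈y)

    pc-d : PairClosed d
    pc-d y z y∈d z∈d =
      let m , y∈ = d⊆stage y∈d
          n , z∈ = d⊆stage z∈d
          y∈′ = stage-mono (≤⇒≤′ (m≤m+n m n)) y y∈
          z∈′ = stage-mono (≤⇒≤′ (m≤n+m n m)) z z∈
      in stage⊆d (1+ (m + n)) _ (upair∈℘ ∅ {s = stage (m + n)} y∈′ z∈′)

  -- Take `ℵ d` for a pair-closed `d` including `κ`, `θ₀` and an ordinal `α` in which `a` embeds:
  -- all three ordinals embed in `d` and so belong to `ℵ d`. As `ω ≼ κ ≼ d`, Hartogs' theorem makes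
  -- `ℵ d` uncountable.
  large-regular : ∀ {κ} → RegularUncountable κ → ∀ a θ₀ → Ordinal θ₀ →
                  ∃[ θ ] RegularUncountable θ × θ₀ ∈ θ × a ≺ θ
  large-regular {κ} (((oκ , _) , ω≼κ , _) , _) a θ₀ oθ₀ =
    let α , oα , a≼α = embeds-in-ordinal a
        d , ⊆d , _ , pc , ∅∈d = pair-closure (κ ∪ θ₀ ∪ α)
        κ≼d = ⊆⇒≼ λ x x∈ → ⊆d x (∪ˡ x x∈)
        κ∈θ = from ∈-ℵ (oκ , κ≼d)
        θ₀∈θ = from ∈-ℵ (oθ₀ , ⊆⇒≼ λ x x∈ → ⊆d x (∪ʳ x (∪ˡ x x∈)))
        α∈θ = from ∈-ℵ (oα , ⊆⇒≼ λ x x∈ → ⊆d x (∪ʳ x (∪ʳ x x∈)))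
    in ℵ d
     , ( ℵ-regular pc ∅∈d (≼-trans ω≼κ (⊆⇒≼ (proj₁ ℵ-ordinal κ κ∈θ)))
       , λ θ≼ω → ℵ⋠ (≼-trans θ≼ω (≼-trans ω≼κ κ≼d)))
     , θ₀∈θ
     , ≼-≺-trans a≼α (proj₂ ℵ-cardinal α α∈θ)

  -- The ordinal bounds the size of the transitive closure of `x`. The intermediate `β` lets a
  -- threshold enlarged by `κ` be used.
  H-bound : ∀ x → ∃[ α ] Ordinal α ×
            (∀ {β θ} → Cardinal θ → α ⊆ β → β ∈ θ → x ∈ H θ)
  H-bound x =
    let t , x⊆t , tr , _ = transitive-closure x
        α , oα , t≼α = embeds-in-ordinal t
    in α , oα , λ card α⊆β β∈θ →
         H-intro x⊆t tr (≼-≺-trans (≼-trans t≼α (⊆⇒≼ α⊆β)) (proj₂ card _ β∈θ))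

  -- Elementary substructures and Skolem functions

  module _ {L : Language} {A : V} (𝔄 : Structure L A) where

    open Structure 𝔄

    Refutable : ∀ {n} → V → Formula L (1+ n) → Vec V n → Set ℓ
    Refutable D φ ρ = ∃[ x ] x ∈ D × ¬ Sat 𝔄 A φ (x ∷ ρ)

    evals-variables : ∀ {n k} (ρ : Vec V n) (is : Vec (Fin n) k) →
                      evals 𝔄 ρ (map var is) ≡ map (lookup ρ) is
    evals-variables ρ []       = refl
    evals-variables ρ (i ∷ is) = cong (lookup ρ i ∷_) (evals-variables ρ is)

    -- The Tarski-Vaught test, with an existential read as the failure of a universal formula.
    tarski-vaught : ∀ {M} → M ⊆ A →
      (∀ {n} (φ : Formula L (1+ n)) ρ → All (_∈ M) ρ → Refutable A φ ρ → Refutable M φ ρ) →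
      M ≺ᵉ 𝔄
    tarski-vaught {M} M⊆A tv = M⊆A , functions , elementary
      where
      functions : ∀ f xs → All (_∈ M) xs → funI f xs ∈ M
      functions f xs xs∈M = subst (_∈ M) x≡ x∈M
        where
        ts : Vec (Term L (1+ (funArity L f))) (funArity L f)
        ts = map var (map fsuc (allFin _))

        evals-ts : ∀ x → evals 𝔄 (x ∷ xs) ts ≡ xs
        evals-ts x = trans (evals-variables (x ∷ xs) _)
          (trans (sym (map-∘ (lookup (x ∷ xs)) fsuc (allFin _))) (map-lookup-allFin xs))

        -- The only counterexample to "`x` differs from `f xs`" is the value `f xs`, so the test
        -- puts it in `M`.
        φ : Formula L (1+ (funArity L f))
        φ = (var zero ≐ fun f ts) ⇒̇ ⊥̇

        refuted : Refutable M φ xs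
        refuted = tv φ xs xs∈M
          ( funI f xs , closed f xs (mapAll (λ {x} → M⊆A x) xs∈M)
          , λ ≢value → ⊥ₚ-elim (≢value (cong (funI f) (sym (evals-ts _)))))

        x : V
        x = proj₁ refuted

        x∈M : x ∈ M
        x∈M = proj₁ (proj₂ refuted)

        x≡ : x ≡ funI f xs
        x≡ = by-contradiction λ x≢ → proj₂ (proj₂ refuted) λ x≡value →
          ⊥-elim (x≢ (trans x≡value (cong (funI f) (evals-ts x))))

      elementary : ∀ {n} (φ : Formula L n) ρ → All (_∈ M) ρ → Sat 𝔄 M φ ρ ⇔ Sat 𝔄 A φ ρ
      elementary (s ≐ t)    ρ ρ∈M = mk⇔ id id
      elementary (rel r ts) ρ ρ∈M = mk⇔ id id
      elementary ⊥̇          ρ ρ∈M = mk⇔ id id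
      elementary (φ ⇒̇ ψ)    ρ ρ∈M = mk⇔
        (λ imp → to (elementary ψ ρ ρ∈M) ∘ imp ∘ from (elementary φ ρ ρ∈M))
        (λ imp → from (elementary ψ ρ ρ∈M) ∘ imp ∘ to (elementary φ ρ ρ∈M))
      elementary (∀̇ φ)      ρ ρ∈M = mk⇔
        (λ all x x∈A → by-contradiction λ ¬φx →
          let y , y∈M , ¬φy = tv φ ρ ρ∈M (x , x∈A , ¬φx)
          in ¬φy (to (elementary φ (y ∷ ρ) (y∈M ∷ ρ∈M)) (all y y∈M)))
        (λ all x x∈M → from (elementary φ (x ∷ ρ) (x∈M ∷ ρ∈M)) (all x (M⊆A x x∈M)))

  ⟦_⟧ : Tree → V
  ⟦ leaf ⟧     = ∅
  ⟦ node a b ⟧ = opair ⟦ a ⟧ ⟦ b ⟧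

  ⟦⟧-injective : ∀ a b → ⟦ a ⟧ ≡ ⟦ b ⟧ → a ≡ b
  ⟦⟧-injective leaf       leaf       _ = refl
  ⟦⟧-injective leaf       (node _ _) e = ⊥-elim (opair≢∅ (sym e))
  ⟦⟧-injective (node _ _) leaf       e = ⊥-elim (opair≢∅ e)
  ⟦⟧-injective (node a b) (node c d) e =
    let p , q = opair-injective e in cong₂ node (⟦⟧-injective a c p) (⟦⟧-injective b d q)

  tuple : ∀ {n} → Vec V n → V
  tuple []      = ∅
  tuple (x ∷ ρ) = opair x (tuple ρ)

  tuple-injective : ∀ {n} (ρ ρ′ : Vec V n) → tuple ρ ≡ tuple ρ′ → ρ ≡ ρ′
  tuple-injective []      []        _ = refl
  tuple-injective (x ∷ ρ) (x′ ∷ ρ′) e =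
    let p , q = opair-injective e in cong₂ _∷_ p (tuple-injective ρ ρ′ q)

  module Skolem {L : Language} (countable : Countable L) {A : V} (𝔄 : Structure L A) where

    open SyntaxCode {L} countable

    Counterexample : V → V → Class
    Counterexample c r x = ∃[ n ] ∃[ φ ] ∃[ a ] ∃[ ρ ]
      FormulaCode {1+ n} φ a × c ≡ ⟦ node (nat n) a ⟧ × r ≡ tuple ρ × x ∈ A × ¬ Sat 𝔄 A φ (x ∷ ρ)

    skolem : V → V → V
    skolem c r = ε (Counterexample c r)

    skolem-spec : ∀ {n a} (φ : Formula L (1+ n)) ρ → FormulaCode φ a → Refutable 𝔄 A φ ρ →
                  let x = skolem ⟦ node (nat n) a ⟧ (tuple ρ) in x ∈ A × ¬ Sat 𝔄 A φ (x ∷ ρ)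
    skolem-spec {n} {a} φ ρ code (y , y∈A , ¬φy)
      with ε-spec {Counterexample ⟦ node (nat n) a ⟧ (tuple ρ)}
                  (y , n , φ , a , ρ , code , refl , refl , y∈A , ¬φy)
    ... | n′ , φ′ , a′ , ρ′ , code′ , c≡ , r≡ , x∈A , ¬φx
      with ⟦⟧-injective (nat n) (nat n′) (proj₁ (opair-injective c≡))
         | ⟦⟧-injective a a′ (proj₂ (opair-injective c≡))
    ... | n≡ | refl with refl ← nat-injective n n′ n≡
      with refl ← formulaCode-injective code code′ | refl ← tuple-injective ρ ρ′ r≡
      = x∈A , ¬φx

    -- Codes and tuples may lie outside `M`: in the application `M` is `M′`, while they are found in
    -- `N`.
    skolem-hull : ∀ {M} → M ⊆ A →
      (∀ a {n} (ρ : Vec V n) → All (_∈ M) ρ → skolem ⟦ a ⟧ (tuple ρ) ∈ A →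
       skolem ⟦ a ⟧ (tuple ρ) ∈ M) →
      M ≺ᵉ 𝔄
    skolem-hull M⊆A hull = tarski-vaught 𝔄 M⊆A λ {n} φ ρ ρ∈M refutable →
      let a , code = formulaCode φ
          x∈A , ¬φx = skolem-spec φ ρ code refutable
      in _ , hull (node (nat n) a) ρ ρ∈M x∈A , ¬φx

  ClosedIn : V → V → (V → V → V → V) → Set ℓ
  ClosedIn A M g = ∀ {x y z} → x ∈ M → y ∈ M → z ∈ M → g x y z ∈ A → g x y z ∈ M

  -- Stationarity is applied to a structure with one ternary function for each operation.
  stationary-closed : ∀ {A S k} → Stationary A S → (gs : Vec (V → V → V → V) k) →
                      ∃[ M ] M ∈ S × All (ClosedIn A M) gs
  stationary-closed {A} {S} {k} stat gs =
    let M , M∈S , _ , M-closed , _ = stat L (mk↣ toℕ-injective , mk↣ {to = λ ()} λ {}) 𝔄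
    in M , M∈S , lookup⁻ λ i {x} {y} {z} x∈M y∈M z∈M g∈A →
         subst (_∈ M) (if-true g∈A) (M-closed i (x ∷ y ∷ z ∷ []) (x∈M ∷ y∈M ∷ z∈M ∷ []))
    where
    L : Language
    L = record { Fun = Fin k ; Rel = ⊥ ; funArity = λ _ → 3 ; relArity = λ () }

    clipped : Fin k → Vec V 3 → V
    -- A value outside `A` is replaced by the first argument, which keeps the function total on `A`.
    clipped i (x ∷ y ∷ z ∷ []) = if (lookup gs i x y z ∈ A) then lookup gs i x y z else x

    clipped∈A : ∀ i xs → All (_∈ A) xs → clipped i xs ∈ A
    clipped∈A i (x ∷ y ∷ z ∷ []) (x∈A ∷ _) with em₀ {lookup gs i x y z ∈ A}
    ... | yes g∈A = g∈A
    ... | no _    = x∈A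

    𝔄 : Structure L A
    𝔄 = record { funI = clipped ; closed = clipped∈A ; relI = λ () }

  -- Mostowski collapses

  module Collapse {M T : V} {σ : V → V} (isCollapse : IsInverseCollapse M T σ) where

    open IsInverseCollapse isCollapse public

    -- By ∈-induction `σ` fixes the elements of `x`, so `x` and its preimage have the same elements.
    -- It is applied to the ordinal `M ∩ κ`.
    fixes-transitive : ∀ {a} → Transitive a → a ⊆ M → ∀ x → x ∈ a → x ∈ T × σ x ≡ x
    fixes-transitive {a} tr a⊆M x = go x (foundation x)
      where
      go : ∀ x → Acc _∈_ x → x ∈ a → x ∈ T × σ x ≡ x
      go x (acc rs) x∈a with surjective x (a⊆M x x∈a)
      ... | y , y∈T , refl = subst (λ z → z ∈ T × σ z ≡ σ y) y≡x (y∈T , refl)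
        where
        y≡x : y ≡ σ y
        y≡x = ⊆-antisym
          (λ z z∈y →
            let z∈T = transitive y y∈T z z∈y
                σz∈σy = to (∈-iso z y z∈T y∈T) z∈y
                σz∈T , σσz≡σz = go (σ z) (rs σz∈σy) (tr _ x∈a _ σz∈σy)
            in subst (_∈ σ y) (injective _ _ σz∈T z∈T σσz≡σz) σz∈σy)
          (λ z z∈σy →
            let z∈T , σz≡z = go z (rs z∈σy) (tr _ x∈a z z∈σy)
            in from (∈-iso z y z∈T y∈T) (subst (_∈ σ y) (sym σz≡z) z∈σy))

    -- The pair, being in `M`, has a preimage `y`; as `T` is transitive, the elements of `y` are in
    -- `T`, and injectivity makes them exactly `u` and `v`.
    σ-upair : ∀ {u v} → u ∈ T → v ∈ T → upair (σ u) (σ v) ∈ M →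
              upair u v ∈ T × σ (upair u v) ≡ upair (σ u) (σ v)
    σ-upair {u} {v} u∈T v∈T p∈M with surjective _ p∈M
    ... | y , y∈T , σy≡ = subst (λ z → z ∈ T × σ z ≡ upair (σ u) (σ v)) y≡ (y∈T , σy≡)
      where
      member : ∀ z → z ∈ T → σ z ∈ upair (σ u) (σ v) → z ∈ y
      member z z∈T σz∈ = from (∈-iso z y z∈T y∈T) (subst (σ z ∈_) (sym σy≡) σz∈)

      y≡ : y ≡ upair u v
      y≡ = ⊆-antisym
        (λ z z∈y →
          let z∈T = transitive y y∈T z z∈y
              σz∈ = subst (σ z ∈_) σy≡ (to (∈-iso z y z∈T y∈T) z∈y)
          in from (∈-upair u v) ([ (λ e → inj₁ (injective z u z∈T u∈T e))
                                 , (λ e → inj₂ (injective z v z∈T v∈T e)) ]′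
                                 (to (∈-upair _ _) σz∈)))
        (λ z z∈ → [ (λ { refl → member z u∈T (left∈ _ _) })
                  , (λ { refl → member z v∈T (right∈ _ _) }) ]′ (to (∈-upair u v) z∈))

    σ-opair : ∀ {u v} → u ∈ T → v ∈ T →
              singleton (σ u) ∈ M → upair (σ u) (σ v) ∈ M → opair (σ u) (σ v) ∈ M →
              opair u v ∈ T × σ (opair u v) ≡ opair (σ u) (σ v)
    σ-opair u∈T v∈T s∈M p∈M o∈M =
      let s∈T , σs≡ = σ-upair u∈T u∈T s∈M
          p∈T , σp≡ = σ-upair u∈T v∈T p∈M
          e = cong₂ upair σs≡ σp≡
          o∈T , σo≡ = σ-upair s∈T p∈T (subst (_∈ M) (sym e) o∈M)
      in o∈T , trans σo≡ e

    -- Transitivity of `h` keeps the cut-down domain transitive, so `M ∩ h` collapses by the same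
    -- `σ` and its elements keep their collapses.
    restrict : ∀ {h} → Transitive h → IsInverseCollapse (M ∩ h) (T ∩ᶜ λ y → σ y ∈ h) σ
    restrict tr-h = record
      { transitive = λ y y∈ z z∈y →
          let y∈T , σy∈h = to ∈-∩ᶜ y∈
              z∈T = transitive y y∈T z z∈y
          in from ∈-∩ᶜ (z∈T , tr-h _ σy∈h _ (to (∈-iso z y z∈T y∈T) z∈y))
      ; maps       = λ y y∈ → let y∈T , σy∈h = to ∈-∩ᶜ y∈ in from ∈-∩ᶜ (maps y y∈T , σy∈h)
      ; injective  = λ y z y∈ z∈ → injective y z (proj₁ (to ∈-∩ᶜ y∈)) (proj₁ (to ∈-∩ᶜ z∈))
      ; surjective = λ x x∈ →
          let x∈M , x∈h = to ∈-∩ᶜ x∈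
              y , y∈T , σy≡x = surjective x x∈M
          in y , from ∈-∩ᶜ (y∈T , subst (_∈ _) (sym σy≡x) x∈h) , σy≡x
      ; ∈-iso      = λ y z y∈ z∈ → ∈-iso y z (proj₁ (to ∈-∩ᶜ y∈)) (proj₁ (to ∈-∩ᶜ z∈))
      }

  -- Laver diamonds

  module _ (κ : V) (κ-regular : RegularUncountable κ) (Γ : Class) where

    -- From guessing by equality to guessing by membership

    κ-ordinal : Ordinal κ
    κ-ordinal = proj₁ (proj₁ (proj₁ κ-regular))

    -- Descending along `∈` inside `M` reaches an element with no members in `M`; by elementarity it
    -- has none in `H θ`, and by transitivity of `H θ` none at all.
    ≺H⇒∅∈ : ∀ {M θ} → M ≺ᵉ ⟨ H θ ,∈⟩ → ∀ x → x ∈ M → ∃[ e ] e ∈ M × IsEmpty e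
    ≺H⇒∅∈ {M} {θ} (M⊆H , _ , elementary) x = go x (foundation x)
      where
      empty : Formula L∈ 1
      empty = ∀̇ (rel tt (var zero ∷ var (fsuc zero) ∷ []) ⇒̇ ⊥̇)

      go : ∀ x → Acc _∈_ x → x ∈ M → ∃[ e ] e ∈ M × IsEmpty e
      go x (acc rs) x∈M with em₀ {∃[ y ] y ∈ x × y ∈ M}
      ... | yes (y , y∈x , y∈M) = go y (rs y∈x) y∈M
      ... | no none = x , x∈M , λ y y∈x →
        ⊥ₚ-elim (to (elementary empty (x ∷ []) (x∈M ∷ []))
                    (λ z z∈M z∈x → ⊥-elim (none (z , z∈x , z∈M)))
                    y (H-transitive x (M⊆H x x∈M) y y∈x) y∈x)

    empty∈κ : ∀ {e} → IsEmpty e → e ∈ κ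
    empty∈κ {e} empty with comparable {e} {κ} e-ordinal κ-ordinal
      where
      e-ordinal : Ordinal e
      e-ordinal = (λ x x∈e → ⊥-elim (empty x x∈e)) , λ x x∈e → ⊥-elim (empty x x∈e)
    ... | inj₁ e∈κ         = e∈κ
    ... | inj₂ (inj₁ refl) = ⊥-elim (proj₂ κ-regular (⊆⇒≼ λ x x∈e → ⊥-elim (empty x x∈e)))
    ... | inj₂ (inj₂ κ∈e)  = ⊥-elim (empty κ κ∈e)

    ◇Lav⇒◇⁻Lav : ◇Lav κ Γ → ◇⁻Lav κ Γ
    ◇Lav⇒◇⁻Lav (F , guess) = F⁻ , guess⁻ , small
      where
      F⁻ : V → V
      F⁻ α = singleton (F α) ∩ᶜ λ _ → ∃[ x ] x ∈ α

      small : ∀ α → α ∈ κ → F⁻ α ≼ α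
      small α _ =
        (λ _ → ε (_∈ α)) , (λ y y∈ → ε-spec (proj₂ (to ∈-∩ᶜ y∈))) ,
        λ x y x∈ y∈ _ → trans (∈-singleton (proj₁ (to ∈-∩ᶜ x∈)))
                              (sym (∈-singleton (proj₁ (to ∈-∩ᶜ y∈))))

      ∈-F⁻ : ∀ {M b θ} → M ∈ G _≡_ κ F b θ → M ∈ G _∈_ κ F⁻ b θ
      ∈-F⁻ {M} {b} M∈G = reflect (to ∈-∩ᶜ M∈G)
        where
        reflect : ∀ {θ} → M ∈ ℘ (H θ) × (b ∈ M × M ≺ᵉ ⟨ H θ ,∈⟩) × (M ∩ κ) ∈ κ ×
                    (∃[ c ] CollapsesTo M b c × c ≡ F (M ∩ κ)) →
                  M ∈ G _∈_ κ F⁻ b θ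
        reflect (M∈℘ , (b∈M , M≺) , M∩κ∈κ , c , collapse , refl) =
          let e , e∈M , empty = ≺H⇒∅∈ M≺ b b∈M
              c∈F⁻ = from ∈-∩ᶜ (left∈ _ _ , e , from ∈-∩ᶜ (e∈M , empty∈κ empty))
          in from ∈-∩ᶜ (M∈℘ , (b∈M , M≺) , M∩κ∈κ , c , collapse , c∈F⁻)

      guess⁻ : ∀ b → ForSufficientlyLargeRegular λ θ → Stationary (H θ) (G _∈_ κ F⁻ b θ ∩ᶜ Γ)
      guess⁻ b =
        let θ₀ , oθ₀ , stat = guess b
        in θ₀ , oθ₀ , λ θ regular θ₀∈θ L countable 𝔄 →
          let M , M∈ , M≺𝔄 = stat θ regular θ₀∈θ L countable 𝔄
              M∈G , M∈Γ = to ∈-∩ᶜ M∈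
          in M , from ∈-∩ᶜ (∈-F⁻ M∈G , M∈Γ) , M≺𝔄

    -- From guessing by membership to guessing by equality

    record Failure (F : V → V) : Set (suc ℓ) where
      field
        b θ       : V
        regular   : RegularUncountable θ
        b∈H       : b ∈ H θ
        κ⊆H       : κ ⊆ H θ
        L         : Language
        countable : Countable L
        𝔄         : Structure L (H θ)
        omits     : ∀ M → M ∈ (G _≡_ κ F b θ ∩ᶜ Γ) → ¬ M ≺ᵉ 𝔄

    -- The threshold `κ ∪ α` forces the failure to occur at a `θ` with `κ ⊆ H θ` and `b ∈ H θ`.
    failure : ∀ F → ¬ Is◇Lav-function κ Γ F → Failure F
    failure F ¬guess = decidable-stable em λ none → ¬guess λ b →
      let α , oα , b∈H = H-bound b
      in κ ∪ α , ∪-ordinal κ-ordinal oα , λ θ reg θ₀∈θ L countable 𝔄 →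
        by-contradiction λ omitted →
          let card = proj₁ (proj₁ reg)
          in none record
            { b = b ; θ = θ ; regular = reg
            ; b∈H = b∈H card ∪ʳ θ₀∈θ
            ; κ⊆H = λ ξ ξ∈κ → cardinal⊆H card ξ (proj₁ (proj₁ card) _ θ₀∈θ ξ (∪ˡ ξ ξ∈κ))
            ; L = L ; countable = countable ; 𝔄 = 𝔄
            ; omits = λ M M∈ M≺ → omitted (M , M∈ , M≺)
            }

    module Slices (projects : ProjectsDownward Γ) (F : V → V)
                  (guess : Is◇⁻Lav-function κ Γ F) where

      index : V → V → V
      index α = embedding (F α) α

      index-spec : ∀ {α} → α ∈ κ → Maps (index α) (F α) α × InjectiveOn (F α) (index α)
      index-spec {α} α∈κ = embedding-spec (proj₂ guess α α∈κ)

      -- This is F_ξ: for `α` in `κ`, the index singles out at most one `c` in `F α`, which is read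
      -- as the graph of a function and evaluated at `ξ`.
      slice : V → V → V
      slice ξ α = ε λ y → ∃[ c ] c ∈ F α × index α c ≡ ξ × opair ξ y ∈ c

      module Reflection (failures : ∀ ξ → Failure (slice ξ)) where

        open module Fail ξ = Failure (failures ξ)

        graph : V
        graph = image (λ ξ → opair ξ (b ξ)) κ

        fst : V → V
        fst p = ε λ x → ∃[ y ] p ≡ opair x y

        fst-opair : ∀ x y → fst (opair x y) ≡ x
        fst-opair x y = sym (proj₁ (opair-injective (proj₂
          (ε-spec {λ x′ → ∃[ y′ ] opair x y ≡ opair x′ y′} (x , y , refl)))))

        L∈-countable : Countable L∈
        L∈-countable = mk↣ {to = λ ()} (λ {}) , mk↣ {to = λ _ → 0} (λ _ → refl)

        -- Three arguments are what a Skolem operation takes: `ξ`, a code and a tuple. `fst`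
        -- recovers the index of an element of `graph`, and `succ (θ ξ)` puts `θ ξ` below the
        -- supremum of the ordinals of `M`, as `ProjectsDownward` requires.
        operations : Vec (V → V → V → V) 7
        operations = (λ _ _ _ → ∅) ∷ (λ x y _ → upair x y) ∷ (λ p _ _ → fst p)
                   ∷ (λ ξ _ _ → b ξ) ∷ (λ ξ _ _ → succ (θ ξ))
                   ∷ (λ ξ → Skolem.skolem (countable ξ) (𝔄 ξ))
                   ∷ (λ ξ → Skolem.skolem L∈-countable ⟨ H (θ ξ) ,∈⟩) ∷ []

        -- Every object met in M below some H (θ ξ), including codes of formulas and
        -- tuples, lies in a transitive pair-closed superset of this set, so
        -- H Θ need only contain such a superset.
        bounds : V
        bounds = image (λ ξ → upair (H (θ ξ)) (succ (θ ξ))) κ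

        module Hull
          (d : V) (bounds⊆d : bounds ⊆ d)
          (d-transitive : Transitive d) (d-pairs : PairClosed d) (∅∈d : ∅ ∈ d)
          (Θ : V) (d⊆H : d ⊆ H Θ)
          (M : V) (M∈Γ : Γ M) (graph∈M : graph ∈ M)
          (closed-at : ∀ i → ClosedIn (H Θ) M (lookup operations i))
          (α∈κ : (M ∩ κ) ∈ κ)
          (T : V) (σ : V → V) (isCollapse : IsInverseCollapse M T σ)
          (c : V) (c∈F : c ∈ F (M ∩ κ)) (c∈T : c ∈ T) (σc≡graph : σ c ≡ graph)
          where

          open Collapse isCollapse

          in-d : ∀ {η} → η ∈ κ → upair (H (θ η)) (succ (θ η)) ∈ d
          in-d η∈κ = bounds⊆d _ (from ∈-image (_ , η∈κ , refl))

          H⊆d : ∀ {η} → η ∈ κ → H (θ η) ⊆ d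
          H⊆d η∈κ = d-transitive _ (d-transitive _ (in-d η∈κ) _ (left∈ _ _))

          succ∈d : ∀ {η} → η ∈ κ → succ (θ η) ∈ d
          succ∈d η∈κ = d-transitive _ (in-d η∈κ) _ (right∈ _ _)

          α : V
          α = M ∩ κ

          α⊆M : α ⊆ M
          α⊆M x x∈α = proj₁ (to ∈-∩ᶜ x∈α)

          ξ : V
          ξ = index α c

          ξ∈α : ξ ∈ α
          ξ∈α = proj₁ (index-spec α∈κ) c c∈F

          ξ∈M : ξ ∈ M
          ξ∈M = α⊆M ξ ξ∈α

          ξ∈κ : ξ ∈ κ
          ξ∈κ = proj₂ (to ∈-∩ᶜ ξ∈α)

          -- `M` is closed only where values stay in `H Θ`. Pairs of elements of `d` stay in
          -- `d ⊆ H Θ`, so this part of `M` is pair-closed and contains all codes and tuples.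
          N : V
          N = M ∩ d

          N-∅ : ∅ ∈ N
          N-∅ = from ∈-∩ᶜ (closed-at (# 0) graph∈M graph∈M graph∈M (d⊆H _ ∅∈d) , ∅∈d)

          N-pairs : PairClosed N
          N-pairs x y x∈ y∈ =
            let x∈M , x∈d = to ∈-∩ᶜ x∈
                y∈M , y∈d = to ∈-∩ᶜ y∈
                p∈d = d-pairs x y x∈d y∈d
            in from ∈-∩ᶜ (closed-at (# 1) x∈M y∈M graph∈M (d⊆H _ p∈d) , p∈d)

          N⊆M : ∀ {x} → x ∈ N → x ∈ M
          N⊆M x∈ = proj₁ (to ∈-∩ᶜ x∈)

          N-tree : ∀ a → ⟦ a ⟧ ∈ N
          N-tree leaf       = N-∅
          N-tree (node a b) = opair-closed N-pairs (N-tree a) (N-tree b)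

          N-tuple : ∀ {n} {ρ : Vec V n} → All (_∈ N) ρ → tuple ρ ∈ N
          N-tuple []          = N-∅
          N-tuple (x∈N ∷ ρ∈N) = opair-closed N-pairs x∈N (N-tuple ρ∈N)

          M-fst : ∀ {x y} → x ∈ κ → opair x y ∈ M → x ∈ M
          M-fst {x} {y} x∈κ p∈M = subst (_∈ M) (fst-opair x y)
            (closed-at (# 2) p∈M p∈M p∈M (subst (_∈ H Θ) (sym (fst-opair x y)) x∈H))
            where
            x∈H : x ∈ H Θ
            x∈H = d⊆H _ (H⊆d x∈κ x (κ⊆H x x x∈κ))

          N-κ : ∀ {η} → η ∈ M → η ∈ κ → η ∈ N
          N-κ η∈M η∈κ = from ∈-∩ᶜ (η∈M , H⊆d η∈κ _ (κ⊆H _ _ η∈κ))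

          N-b : ∀ {η} → η ∈ M → η ∈ κ → b η ∈ N
          N-b η∈M η∈κ = from ∈-∩ᶜ (closed-at (# 3) η∈M η∈M η∈M (d⊆H _ bη∈d) , bη∈d)
            where bη∈d = H⊆d η∈κ _ (b∈H _)

          -- As `η` is below `M ∩ κ`, the collapse fixes it; so it sends the pair of `η` and `b η`
          -- to the pair of `η` and the collapse of `b η`.
          preimage : ∀ {η} → η ∈ M → η ∈ κ →
                     ∃[ y ] y ∈ T × σ y ≡ b η × opair η y ∈ T × σ (opair η y) ≡ opair η (b η)
          preimage {η} η∈M η∈κ =
            y , y∈T , σy≡b , o∈T , trans σo≡ (cong₂ opair ση≡η σy≡b)
            where
            fixed : η ∈ T × σ η ≡ η
            fixed = fixes-transitive (proj₂ κ-ordinal α α∈κ) α⊆M η (from ∈-∩ᶜ (η∈M , η∈κ))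
            ση≡η = proj₂ fixed
            found = surjective (b η) (N⊆M (N-b η∈M η∈κ))
            y = proj₁ found
            y∈T = proj₁ (proj₂ found)
            σy≡b = proj₂ (proj₂ found)

            ση∈N : σ η ∈ N
            ση∈N = subst (_∈ N) (sym ση≡η) (N-κ η∈M η∈κ)

            σy∈N : σ y ∈ N
            σy∈N = subst (_∈ N) (sym σy≡b) (N-b η∈M η∈κ)

            lifted : opair η y ∈ T × σ (opair η y) ≡ opair (σ η) (σ y)
            lifted = σ-opair (proj₁ fixed) y∈T (N⊆M (N-pairs _ _ ση∈N ση∈N))
                       (N⊆M (N-pairs _ _ ση∈N σy∈N)) (N⊆M (opair-closed N-pairs ση∈N σy∈N))
            o∈T = proj₁ lifted
            σo≡ = proj₂ lifted

          slice-spec : ∃[ c′ ] c′ ∈ F α × index α c′ ≡ ξ × opair ξ (slice ξ α) ∈ c′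
          slice-spec = ε-spec {λ y → ∃[ c′ ] c′ ∈ F α × index α c′ ≡ ξ × opair ξ y ∈ c′}
            -- The collapse of `b ξ` is a possible value: `σ` carries its pair with `ξ` into
            -- `graph`, which is `σ c`.
            (let y , _ , _ , o∈T , σo≡ = preimage ξ∈M ξ∈κ
             in y , c , c∈F , refl , from (∈-iso _ _ o∈T c∈T)
                  (subst (_∈ σ c) (sym σo≡) (subst (opair ξ (b ξ) ∈_) (sym σc≡graph)
                  (from ∈-image (ξ , ξ∈κ , refl)))))

          c-elements : ∀ {p} → p ∈ c → p ∈ T × ∃[ η ] η ∈ κ × σ p ≡ opair η (b η)
          c-elements {p} p∈c =
            let p∈T = transitive c c∈T p p∈c
            in p∈T , to ∈-image (subst (σ p ∈_) σc≡graph (to (∈-iso p c p∈T c∈T) p∈c))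

          -- First `η` is in `M`, as first coordinate of a pair in `M`. Then `preimage` gives
          -- another pair with the same image, and injectivity of `σ` yields `ζ ≡ η` and identifies
          -- `y`.
          second-component : ∀ {ζ η y} → η ∈ κ → opair ζ y ∈ T → σ (opair ζ y) ≡ opair η (b η) →
                             y ∈ T × σ y ≡ b ζ
          second-component {ζ} {η} {y} η∈κ o∈T σo≡ =
            collapse-of (preimage (M-fst η∈κ (subst (_∈ M) σo≡ (maps _ o∈T))) η∈κ)
            where
            collapse-of : ∃[ y′ ] y′ ∈ T × σ y′ ≡ b η × opair η y′ ∈ T × σ (opair η y′) ≡ opair η (b η) →
                          y ∈ T × σ y ≡ b ζ
            collapse-of (y′ , y′∈T , σy′≡ , o′∈T , σo′≡) =
              let ζ≡η , y≡y′ = opair-injective (injective _ _ o∈T o′∈T (trans σo≡ (sym σo′≡)))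
              in subst (_∈ T) (sym y≡y′) y′∈T , trans (cong σ y≡y′) (trans σy′≡ (cong b (sym ζ≡η)))

          -- The choice in `slice` may have used another `c′`, but equal indices give `c′ ≡ c`.
          slice∈c : opair ξ (slice ξ α) ∈ c
          slice∈c =
            let c′ , c′∈F , index≡ , o∈c′ = slice-spec
            in subst (opair ξ (slice ξ α) ∈_) (proj₂ (index-spec α∈κ) c′ c c′∈F c∈F index≡) o∈c′

          slice-collapses : slice ξ α ∈ T × σ (slice ξ α) ≡ b ξ
          slice-collapses =
            let o∈T , η , η∈κ , σo≡ = c-elements slice∈c
            in second-component η∈κ o∈T σo≡

          M′ : V
          M′ = M ∩ H (θ ξ)

          M′⊆H : M′ ⊆ H (θ ξ)
          M′⊆H x x∈ = proj₂ (to ∈-∩ᶜ x∈)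

          M′⊆N : ∀ {x} → x ∈ M′ → x ∈ N
          M′⊆N x∈ = let x∈M , x∈H = to ∈-∩ᶜ x∈ in from ∈-∩ᶜ (x∈M , H⊆d ξ∈κ _ x∈H)

          -- The arguments lie in `M`, and the value lies in `H (θ ξ) ⊆ d ⊆ H Θ`, where closure of
          -- `M` applies. It serves both Skolem operations.
          hull : ∀ i {a n} {ρ : Vec V n} → All (_∈ M′) ρ → let g = lookup operations i in
                 g ξ ⟦ a ⟧ (tuple ρ) ∈ H (θ ξ) → g ξ ⟦ a ⟧ (tuple ρ) ∈ M′
          hull i {a} ρ∈M′ g∈H = from ∈-∩ᶜ
            ( closed-at i ξ∈M (N⊆M (N-tree a)) (N⊆M (N-tuple (mapAll M′⊆N ρ∈M′)))
                (d⊆H _ (H⊆d ξ∈κ _ g∈H))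
            , g∈H)

          M′≺𝔄 : M′ ≺ᵉ 𝔄 ξ
          M′≺𝔄 = Skolem.skolem-hull (countable ξ) (𝔄 ξ) M′⊆H λ a ρ → hull (# 5) {a}

          M′≺∈ : M′ ≺ᵉ ⟨ H (θ ξ) ,∈⟩
          M′≺∈ = Skolem.skolem-hull L∈-countable ⟨ H (θ ξ) ,∈⟩ M′⊆H λ a ρ → hull (# 6) {a}

          M′∩κ≡α : M′ ∩ κ ≡ α
          M′∩κ≡α = ⊆-antisym
            (λ x x∈ → let x∈M′ , x∈κ = to ∈-∩ᶜ x∈
                      in from ∈-∩ᶜ (proj₁ (to ∈-∩ᶜ x∈M′) , x∈κ))
            (λ x x∈ → let x∈M , x∈κ = to ∈-∩ᶜ x∈
                      in from ∈-∩ᶜ (from ∈-∩ᶜ (x∈M , κ⊆H ξ x x∈κ) , x∈κ))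

          M′∈Γ : Γ M′
          M′∈Γ = projects M (θ ξ) M∈Γ (regular ξ) (inj₁ (from ∈-⋃
            ( succ (θ ξ)
            , from ∈-∩ᶜ ( closed-at (# 4) ξ∈M ξ∈M ξ∈M (d⊆H _ (succ∈d ξ∈κ))
                        , succ-ordinal (proj₁ (proj₁ (proj₁ (regular ξ)))))
            , self∈succ)))

          M′∈ : M′ ∈ (G _≡_ κ (slice ξ) (b ξ) (θ ξ) ∩ᶜ Γ)
          M′∈ = from ∈-∩ᶜ
            ( from ∈-∩ᶜ
                ( from ∈-℘ M′⊆H
                , (from ∈-∩ᶜ (N⊆M (N-b ξ∈M ξ∈κ) , b∈H ξ) , M′≺∈)
                , subst (_∈ κ) (sym M′∩κ≡α) α∈κ
                , slice ξ α
                , ( _ , σ , restrict H-transitive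
                  , from ∈-∩ᶜ ( proj₁ slice-collapses
                              , subst (_∈ H (θ ξ)) (sym (proj₂ slice-collapses)) (b∈H ξ))
                  , proj₂ slice-collapses)
                , cong (slice ξ) (sym M′∩κ≡α))
            , M′∈Γ)

          absurd : ⊥
          absurd = omits ξ M′ M′∈ M′≺𝔄

        impossible : ⊥
        impossible =
          let d , d-spec = pair-closure bounds
              θ₀ , oθ₀ , stat = proj₁ guess graph
              -- With `d` transitive and smaller than `Θ`, all the `H (θ ξ)` for `ξ` in `κ` lie
              -- inside `H Θ`.
              Θ , Θ-regular , θ₀∈Θ , d≺Θ = large-regular κ-regular d θ₀ oθ₀
              M , M∈ , closed-in = stationary-closed (stat Θ Θ-regular θ₀∈Θ) operations
              M∈G , M∈Γ = to ∈-∩ᶜ M∈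
          in reflect d d-spec d≺Θ M∈Γ (lookup⁺ closed-in) (proj₂ (to ∈-∩ᶜ M∈G))
          where
          reflect : ∀ d {Θ M} → bounds ⊆ d × Transitive d × PairClosed d × ∅ ∈ d → d ≺ Θ →
                    Γ M → (∀ i → ClosedIn (H Θ) M (lookup operations i)) →
                    (graph ∈ M × M ≺ᵉ ⟨ H Θ ,∈⟩) × (M ∩ κ) ∈ κ ×
                      (∃[ c ] CollapsesTo M graph c × c ∈ F (M ∩ κ)) →
                    ⊥
          reflect d {Θ} {M} (bounds⊆d , d-transitive , d-pairs , ∅∈d) d≺Θ M∈Γ closed-at
                  ((graph∈M , _) , α∈κ , c , (T , σ , isCollapse , c∈T , σc≡graph) , c∈F) =
            Hull.absurd d bounds⊆d d-transitive d-pairs ∅∈d Θ (transitive⊆H d-transitive d≺Θ)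
              M M∈Γ graph∈M closed-at α∈κ T σ isCollapse c c∈F c∈T σc≡graph

    ◇⁻Lav⇒◇Lav : ProjectsDownward Γ → ◇⁻Lav κ Γ → ◇Lav κ Γ
    ◇⁻Lav⇒◇Lav projects (F , guess) = decidable-stable em λ none →
      Reflection.impossible λ ξ → failure (slice ξ) λ slice-guesses → none (slice ξ , slice-guesses)
      where open Slices projects F guess

theorem2p1 : ∀ {ℓ : Level} → ExcludedMiddle (suc ℓ) → (𝕍 : ZFC ℓ) →
    let open SetTheory 𝕍 in
    (κ : V) → RegularUncountable κ →
    (Γ : Class) → ProjectsDownward Γ → (∀ M → Γ M → (M ∩ κ) ∈ κ) →
    ◇⁻Lav κ Γ ⇔ ◇Lav κ Γ
theorem2p1 em 𝕍 κ κ-regular Γ projects _ =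
  mk⇔ (◇⁻Lav⇒◇Lav κ κ-regular Γ projects) (◇Lav⇒◇⁻Lav κ κ-regular Γ)
  where open Classical em 𝕍
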